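{- Let $m,n$ be positive integers and let $(X,Y)$ be the bipartition of the complete bipartite graph $K_{m,n}$ with $|X|=m$ and $|Y|=n$. Let $F$ be any spanning forest of $K_{m,n}$ with components $T_1,T_2,\ldots,T_k$, and let $m_i=|X\cap V(T_i)|$ and $n_i=|Y\cap V(T_i)|$ for $i=1,\ldots,k$. Then the number $\tau_F(K_{m,n})$ of spanning trees of $K_{m,n}$ that contain all edges of $F$ equals $$\tau_{F}(K_{m,n})=\frac 1{mn}\left(\prod_{i=1}^k (m_in+n_im)\right)\left (1-\sum_{i=1}^{k}\frac{m_in_i}{m_in+n_im}\right ).$$
   Context: For a graph $G$ and a subgraph $H$, $\tau_H(G)$ denotes the number of spanning trees $T$ of $G$ with $E(H)\subseteq E(T)$. -}

module Defs where

open import Data.Nat using (ℕ; zero; suc; _+_; _*_; _≤_)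
open import Data.Fin using (Fin; zero; suc; _≟_)
open import Data.Sum using (_⊎_; inj₁; inj₂)
open import Data.Product using (Σ; _×_; _,_)
open import Data.Bool using (Bool; true; false; if_then_else_)
open import Data.Vec using (Vec; lookup)
open import Data.List using (List; []; _∷_; _++_; [_]; length)
open import Data.List.Relation.Unary.Linked using (Linked)
open import Data.List.Relation.Unary.Unique.Propositional using (Unique)
open import Data.List.Membership.Propositional using (_∈_)
open import Relation.Binary.Construct.Closure.ReflexiveTransitive using (Star)
open import Relation.Binary.PropositionalEquality using (_≡_)
open import Relation.Nullary using (¬_; yes; no; does)
open import Function.Bundles using (_⇔_)

-- Vertices of K_{m,n}: X = Fin m (inj₁), Y = Fin n (inj₂).
V : ℕ → ℕ → Set
V m n = Fin m ⊎ Fin n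

-- A spanning subgraph of K_{m,n} is given by its edge set: an m×n Boolean
-- matrix; entry (x,y) is true iff the edge xy is present.
EdgeSet : ℕ → ℕ → Set
EdgeSet m n = Vec (Vec Bool n) m

HasEdge : ∀ {m n} → EdgeSet m n → Fin m → Fin n → Set
HasEdge E x y = lookup (lookup E x) y ≡ true

data Adj {m n : ℕ} (E : EdgeSet m n) : V m n → V m n → Set where
  xy : ∀ {x y} → HasEdge E x y → Adj E (inj₁ x) (inj₂ y)
  yx : ∀ {x y} → HasEdge E x y → Adj E (inj₂ y) (inj₁ x)

Connected : ∀ {m n} → EdgeSet m n → V m n → V m n → Set
Connected E = Star (Adj E)

HasCycle : ∀ {m n} → EdgeSet m n → Set
HasCycle {m} {n} E =
  Σ (V m n) λ v0 → Σ (List (V m n)) λ rest →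
    (3 ≤ length (v0 ∷ rest)) × Unique (v0 ∷ rest) × Linked (Adj E) ((v0 ∷ rest) ++ [ v0 ])

Acyclic : ∀ {m n} → EdgeSet m n → Set
Acyclic E = ¬ HasCycle E

IsSpanningTree : ∀ {m n} → EdgeSet m n → Set
IsSpanningTree E = (∀ u v → Connected E u v) × Acyclic E

IsSpanningForest : ∀ {m n} → EdgeSet m n → Set
IsSpanningForest E = Acyclic E

_⊆E_ : ∀ {m n} → EdgeSet m n → EdgeSet m n → Set
F ⊆E T = ∀ x y → HasEdge F x y → HasEdge T x y

IsCount : ∀ {m n} → (EdgeSet m n → Set) → ℕ → Set
IsCount {m} {n} P N =
  Σ (List (EdgeSet m n)) λ L → Unique L × (∀ T → (T ∈ L) ⇔ P T) × (length L ≡ N)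

TauIs : ∀ {m n} → EdgeSet m n → ℕ → Set
TauIs F N = IsCount (λ T → (F ⊆E T) × IsSpanningTree T) N

sumF : ∀ {k} → (Fin k → ℕ) → ℕ
sumF {zero} f = 0
sumF {suc k} f = f zero + sumF (λ i → f (suc i))

prodF : ∀ {k} → (Fin k → ℕ) → ℕ
prodF {zero} f = 1
prodF {suc k} f = f zero * prodF (λ i → f (suc i))

prodExcept : ∀ {k} → (Fin k → ℕ) → Fin k → ℕ
prodExcept f i = prodF (λ j → if does (i ≟ j) then 1 else f j)

countF : ∀ {r k} → (Fin r → Fin k) → Fin k → ℕ
countF c i = sumF (λ a → if does (c a ≟ i) then 1 else 0)

{-# OPTIONS --safe #-}
module Submission where

-- Write a_i, b_i for the numbers of X- and Y-vertices of the component i, w_i = a_i n + b_i m, and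
-- s = Σ a_i b_i / w_i; the claim is that m n τ_F = (Π w_i)(1 − s).  A spanning tree containing F has
-- k − 1 edges outside F, each joining two components, so double counting gives
-- (k − 1) τ_F = Σ τ_{F+xy} over the edges xy between different components.  By induction on k it
-- remains to see that (Π w_i)(1 − s) satisfies the same recurrence.  Merging the components i and j
-- turns it into Π w_i times a polynomial in the a, b and 1/w of i and j and in s; the sum of these over
-- all edges is evaluated with n Σ a_i²/w_i = m (1 − s) and m Σ b_i²/w_i = n (1 − s).

open import Defs
open import Algebra.Bundles using (CommutativeMonoid; CommutativeRing)
open import Data.Bool using (Bool; true; false; if_then_else_)
import Data.Bool.Properties as Bool
open import Data.Fin using (Fin; zero; suc; fromℕ<; punchIn; _≟_)
open import Data.Fin.Properties using (punchInᵢ≢i)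
import Data.Integer as ℤ
import Data.Integer.Properties as ℤ
open import Data.List using (List; []; _∷_; _++_; [_]; length; filter)
import Data.List.Membership.DecPropositional as DecMembership
open import Data.List.Membership.Propositional using (_∈_)
open import Data.List.Membership.Propositional.Properties using (∈-filter⁺; ∈-filter⁻)
open import Data.List.Relation.Unary.All using (All; []; _∷_)
open import Data.List.Relation.Unary.All.Properties using (¬Any⇒All¬)
open import Data.List.Relation.Unary.AllPairs using ([]; _∷_)
open import Data.List.Relation.Unary.Any using (here; there)
open import Data.List.Relation.Unary.Linked using (Linked; [-]; _∷_)
open import Data.List.Relation.Unary.Unique.Propositional using (Unique)
open import Data.List.Relation.Unary.Unique.Propositional.Properties using (filter⁺)
open import Data.Nat as ℕ using (ℕ; zero; suc; pred; _≤_; _<_; z≤n; s≤s)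
open import Data.Nat.Coprimality as Coprime using (1-coprimeTo)
import Data.Nat.Properties as ℕ
open import Data.Nat.Tactic.RingSolver using () renaming (solve-∀ to ℕ-solve-∀)
open import Data.Product using (∃; ∃₂; _×_; _,_; proj₁; proj₂)
import Data.Rational.Unnormalised as ℚᵘ
import Data.Rational.Unnormalised.Properties as ℚᵘ
open import Data.Sum using (_⊎_; inj₁; inj₂)
open import Data.Sum.Properties using (≡-dec)
open import Data.Vec using (Vec; lookup; _[_]%=_; _[_]≔_)
open import Data.Vec.Properties using (lookup∘updateAt; lookup∘updateAt′; lookup∘update; lookup∘update′)
open import Data.Vec.Relation.Binary.Pointwise.Extensional using (ext; Pointwise-≡⇒≡)
open import Function using (_∘_; id)
open import Function.Bundles using (_⇔_; mk⇔; Equivalence)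
open import Level using (0ℓ)
open import Relation.Binary.Construct.Closure.ReflexiveTransitive using (Star; ε; _◅_; _◅◅_; reverse; gmap)
open import Relation.Binary.Core using (Rel)
open import Relation.Binary.Definitions using (DecidableEquality)
open import Relation.Binary.PropositionalEquality
  using (_≡_; _≢_; refl; sym; trans; cong; cong₂; subst; module ≡-Reasoning)
open import Relation.Nullary using (¬_; Dec; yes; no; does; contradiction)
open import Relation.Nullary.Decidable using (_×-dec_; dec⇒maybe)
open import Tactic.RingSolver using (solve-∀)
open import Tactic.RingSolver.Core.AlmostCommutativeRing using (AlmostCommutativeRing; fromCommutativeRing)
import Algebra.Properties.CommutativeMonoid.Sum ℕ.+-0-commutativeMonoid as Σℕ
import Algebra.Properties.CommutativeMonoid.Sum ℕ.*-1-commutativeMonoid as Πℕ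

private variable
  m n : ℕ

-- Edges, bridges and connectivity

-- The set `Fin k` of labels stays fixed during the induction: joining two components renames one
-- label to the other, which leaves a label without vertices but spares any reindexing of the
-- families a and b. The number of components is therefore not `k` but `K`, the number of labels of
-- positive weight, and the induction runs on K - 1. That a spanning tree containing F has K - 1
-- edges outside F is not read off from edge counts of trees. The missing edges are added to F one
-- at a time; each lowers K by one, and when none is left K is 1. Reciprocals force the recurrence
-- into ℚ, while the claim is an equation in ℕ without subtraction or division. The return to ℕ
-- happens only for the original labelling, where all weights are positive. Acyclicity is handled
-- through bridges: a graph is acyclic exactly when deleting any edge disconnects its ends. This
-- makes it easy to follow when an edge is added.

setEdge : Bool → EdgeSet m n → Fin m → Fin n → EdgeSet m n
setEdge b E x y = E [ x ]%= (_[ y ]≔ b)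

add del : EdgeSet m n → Fin m → Fin n → EdgeSet m n
add = setEdge true
del = setEdge false

lookup-setEdge : ∀ b (E : EdgeSet m n) x y → lookup (lookup (setEdge b E x y) x) y ≡ b
lookup-setEdge b E x y =
  trans (cong (λ r → lookup r y) (lookup∘updateAt x E)) (lookup∘update y (lookup E x) b)

lookup-setEdge′ : ∀ b (E : EdgeSet m n) x y {x′ y′} → ¬ (x′ ≡ x × y′ ≡ y) →
  lookup (lookup (setEdge b E x y) x′) y′ ≡ lookup (lookup E x′) y′
lookup-setEdge′ b E x y {x′} {y′} ne with x′ ≟ x
... | no x′≢x = cong (λ r → lookup r y′) (lookup∘updateAt′ x′ x x′≢x E)
... | yes refl = trans (cong (λ r → lookup r y′) (lookup∘updateAt x E))
                       (lookup∘update′ (λ e → ne (refl , e)) (lookup E x) b)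

sameEdge? : (x x′ : Fin m) (y y′ : Fin n) → Dec (x′ ≡ x × y′ ≡ y)
sameEdge? x x′ y y′ = (x′ ≟ x) ×-dec (y′ ≟ y)

module _ (E : EdgeSet m n) (x : Fin m) (y : Fin n) where

  add-edge : HasEdge (add E x y) x y
  add-edge = lookup-setEdge true E x y

  add-⊇ : E ⊆E add E x y
  add-⊇ x′ y′ e with sameEdge? x x′ y y′
  ... | yes (refl , refl) = add-edge
  ... | no ne = trans (lookup-setEdge′ true E x y ne) e

  add-inv : ∀ {x′ y′} → HasEdge (add E x y) x′ y′ → (x′ ≡ x × y′ ≡ y) ⊎ HasEdge E x′ y′
  add-inv {x′} {y′} e with sameEdge? x x′ y y′
  ... | yes p = inj₁ p
  ... | no ne = inj₂ (trans (sym (lookup-setEdge′ true E x y ne)) e)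

  del-edge : ∀ {x′ y′} → HasEdge E x′ y′ → ¬ (x′ ≡ x × y′ ≡ y) → HasEdge (del E x y) x′ y′
  del-edge e ne = trans (lookup-setEdge′ false E x y ne) e

  del-inv : ∀ {x′ y′} → HasEdge (del E x y) x′ y′ → HasEdge E x′ y′ × ¬ (x′ ≡ x × y′ ≡ y)
  del-inv {x′} {y′} e with sameEdge? x x′ y y′
  ... | no ne = trans (sym (lookup-setEdge′ false E x y ne)) e , ne
  ... | yes (refl , refl) with () ← trans (sym (lookup-setEdge false E x y)) e

add-least : (F T : EdgeSet m n) {x : Fin m} {y : Fin n} → F ⊆E T → HasEdge T x y → add F x y ⊆E T
add-least F T {x} {y} sub e x′ y′ e′ with add-inv F x y e′
... | inj₁ (refl , refl) = e
... | inj₂ f = sub x′ y′ f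

Adj-mono : {E G : EdgeSet m n} → E ⊆E G → ∀ {u v} → Adj E u v → Adj G u v
Adj-mono sub (xy e) = xy (sub _ _ e)
Adj-mono sub (yx e) = yx (sub _ _ e)

Adj-sym : {E : EdgeSet m n} → ∀ {u v} → Adj E u v → Adj E v u
Adj-sym (xy e) = yx e
Adj-sym (yx e) = xy e

Connected-mono : {E G : EdgeSet m n} → E ⊆E G → ∀ {u v} → Connected E u v → Connected G u v
Connected-mono sub = gmap id (Adj-mono sub)

Connected-sym : {E : EdgeSet m n} → ∀ {u v} → Connected E u v → Connected E v u
Connected-sym = reverse Adj-sym

-- Simple paths, cycles and bridges

module _ {A : Set} {R : Rel A 0ℓ} (_≟ᴬ_ : DecidableEquality A) where

  open DecMembership _≟ᴬ_ using (_∈?_)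

  -- The list index holds every visited vertex, both ends included, so `Unique` of it says that the
  -- path is simple and a closing step turns it into the list required by `HasCycle`.
  data Path : A → A → List A → Set where
    stop : ∀ {u} → Path u u [ u ]
    step : ∀ {u w v ps} → R u w → Path w v ps → Path u v (u ∷ ps)

  Path-suffix : ∀ {u w v ps} → u ∈ ps → Path w v ps → Unique ps → ∃ λ qs → Path u v qs × Unique qs
  Path-suffix (here refl) stop uq = _ , stop , uq
  Path-suffix (here refl) (step r p) uq = _ , step r p , uq
  Path-suffix (there u∈) (step r p) (_ ∷ uq) = Path-suffix u∈ p uq

  loop-erasure : ∀ {u v} → Star R u v → ∃ λ ps → Path u v ps × Unique ps
  loop-erasure ε = _ , stop , [] ∷ []
  loop-erasure (_◅_ {i = u} r rs) with loop-erasure rs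
  ... | ps , p , uq with u ∈? ps
  ...   | yes u∈ = Path-suffix u∈ p uq
  ...   | no u∉ = _ , step r p , ¬Any⇒All¬ ps u∉ ∷ uq

  Path-nonempty : ∀ {u v ps} → Path u v ps → 1 ≤ length ps
  Path-nonempty stop = s≤s z≤n
  Path-nonempty (step _ _) = s≤s z≤n

  Path-close : ∀ {S : Rel A 0ℓ} {u v ps z} → (∀ {a b} → R a b → S a b) → Path u v ps → S v z →
               Linked S (ps ++ [ z ])
  Path-close sub stop s = s ∷ [-]
  Path-close sub (step r stop) s = sub r ∷ s ∷ [-]
  Path-close sub (step r p@(step _ _)) s = sub r ∷ Path-close sub p s

_≟ⱽ_ : DecidableEquality (V m n)
_≟ⱽ_ = ≡-dec _≟_ _≟_

-- A simple path from x to y that avoids the edge xy has at least three vertices, so closing it with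
-- that edge gives a cycle.
acyclic⇒bridge : {E : EdgeSet m n} → Acyclic E → ∀ {x y} → HasEdge E x y →
                 ¬ Connected (del E x y) (inj₁ x) (inj₂ y)
acyclic⇒bridge {E = E} ac {x} {y} e conn with loop-erasure _≟ⱽ_ conn
-- A path with a single step would be the deleted edge itself.
... | _ , step (xy e′) stop , _ = proj₂ (del-inv E x y e′) (refl , refl)
... | _ , p@(step r (step r′ p′)) , uq =
  ac (_ , _ , s≤s (s≤s (Path-nonempty _≟ⱽ_ p′)) , uq ,
      Path-close _≟ⱽ_ (Adj-mono (λ _ _ → proj₁ ∘ del-inv E x y)) p (yx e))

module _ (E : EdgeSet m n) (x : Fin m) (y : Fin n) where

  Adj-del : ∀ {p q} → Adj E p q → ¬ (p ≡ inj₁ x × q ≡ inj₂ y) → ¬ (p ≡ inj₂ y × q ≡ inj₁ x) →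
            Adj (del E x y) p q
  Adj-del (xy e) ne _ = xy (del-edge E x y e λ { (refl , refl) → ne (refl , refl) })
  Adj-del (yx e) _ ne = yx (del-edge E x y e λ { (refl , refl) → ne (refl , refl) })

  -- A step leaving a vertex other than the ends of the deleted edge does not use that edge.
  walk-avoids : ∀ {p ps z} → All (λ v → inj₁ x ≢ v) (p ∷ ps) → All (λ v → inj₂ y ≢ v) (p ∷ ps) →
                Linked (Adj E) ((p ∷ ps) ++ [ z ]) → Connected (del E x y) p z
  walk-avoids {ps = []} (nx ∷ _) (ny ∷ _) (a ∷ [-]) =
    Adj-del a (λ q → nx (sym (proj₁ q))) (λ q → ny (sym (proj₁ q))) ◅ ε
  walk-avoids {ps = _ ∷ _} (nx ∷ nxs) (ny ∷ nys) (a ∷ l) =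
    Adj-del a (λ q → nx (sym (proj₁ q))) (λ q → ny (sym (proj₁ q))) ◅ walk-avoids nxs nys l

-- The first edge of a cycle is no bridge, because the rest of the cycle joins its ends.
bridges⇒acyclic : {E : EdgeSet m n} →
  (∀ {x y} → HasEdge E x y → ¬ Connected (del E x y) (inj₁ x) (inj₂ y)) → Acyclic E
bridges⇒acyclic br (_ , [] , s≤s () , _)
bridges⇒acyclic br (_ , _ ∷ [] , s≤s (s≤s ()) , _)
bridges⇒acyclic {E = E} br (_ , _ ∷ v₂ ∷ rest , _ , ((n01 ∷ n02 ∷ n0) ∷ (n12 ∷ n1) ∷ _) , (xy {x} {y} e ∷ a ∷ l)) =
  -- The second step of the cycle starts at an end of the deleted edge, so `walk-avoids` does not
  -- cover it; it is another edge because the third vertex differs from the first.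
  br e (Connected-sym
    (Adj-del E x y a (λ q → n01 (sym (proj₁ q))) (λ q → n02 (sym (proj₂ q)))
      ◅ walk-avoids E x y (n02 ∷ n0) (n12 ∷ n1) l))
bridges⇒acyclic {E = E} br (_ , _ ∷ v₂ ∷ rest , _ , ((n01 ∷ n02 ∷ n0) ∷ (n12 ∷ n1) ∷ _) , (yx {x} {y} e ∷ a ∷ l)) =
  br e (Adj-del E x y a (λ q → n02 (sym (proj₂ q))) (λ q → n01 (sym (proj₁ q)))
      ◅ walk-avoids E x y (n12 ∷ n1) (n02 ∷ n0) l)

module _ (F : EdgeSet m n) (x : Fin m) (y : Fin n) where

  -- One crossing of the new edge is enough: of two crossings in the same direction the later
  -- suffices, and two in opposite directions can both be cut out.
  Connected-add⁻ : ∀ {u v} → Connected (add F x y) u v →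
    Connected F u v
    ⊎ (Connected F u (inj₁ x) × Connected F (inj₂ y) v)
    ⊎ (Connected F u (inj₂ y) × Connected F (inj₁ x) v)
  Connected-add⁻ ε = inj₁ ε
  Connected-add⁻ (a ◅ as) with Connected-add⁻ as | a
  ... | r | xy e with add-inv F x y e
  Connected-add⁻ (a ◅ as) | inj₁ r               | _ | inj₁ (refl , refl) = inj₂ (inj₁ (ε , r))
  Connected-add⁻ (a ◅ as) | inj₂ (inj₁ (r , s))  | _ | inj₁ (refl , refl) = inj₂ (inj₁ (ε , s))
  Connected-add⁻ (a ◅ as) | inj₂ (inj₂ (r , s))  | _ | inj₁ (refl , refl) = inj₁ s
  Connected-add⁻ (a ◅ as) | inj₁ r               | _ | inj₂ f = inj₁ (xy f ◅ r)
  Connected-add⁻ (a ◅ as) | inj₂ (inj₁ (r , s))  | _ | inj₂ f = inj₂ (inj₁ (xy f ◅ r , s))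
  Connected-add⁻ (a ◅ as) | inj₂ (inj₂ (r , s))  | _ | inj₂ f = inj₂ (inj₂ (xy f ◅ r , s))
  Connected-add⁻ (a ◅ as) | r | yx e with add-inv F x y e
  Connected-add⁻ (a ◅ as) | inj₁ r               | _ | inj₁ (refl , refl) = inj₂ (inj₂ (ε , r))
  Connected-add⁻ (a ◅ as) | inj₂ (inj₁ (r , s))  | _ | inj₁ (refl , refl) = inj₁ s
  Connected-add⁻ (a ◅ as) | inj₂ (inj₂ (r , s))  | _ | inj₁ (refl , refl) = inj₂ (inj₂ (ε , s))
  Connected-add⁻ (a ◅ as) | inj₁ r               | _ | inj₂ f = inj₁ (yx f ◅ r)
  Connected-add⁻ (a ◅ as) | inj₂ (inj₁ (r , s))  | _ | inj₂ f = inj₂ (inj₁ (yx f ◅ r , s))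
  Connected-add⁻ (a ◅ as) | inj₂ (inj₂ (r , s))  | _ | inj₂ f = inj₂ (inj₂ (yx f ◅ r , s))

module _ (F : EdgeSet m n) (x : Fin m) (y : Fin n) where

  -- Every edge of the enlarged graph is a bridge. Deleting the new edge leads back into F, where
  -- its ends are separated; for an old edge x′y′, a connection of its ends that crosses xy would
  -- close up through x′y′ to a connection of x and y in F.
  acyclic-add : Acyclic F → ¬ Connected F (inj₁ x) (inj₂ y) → Acyclic (add F x y)
  acyclic-add ac nc = bridges⇒acyclic bridge
    where
    bridge : ∀ {x′ y′} → HasEdge (add F x y) x′ y′ →
             ¬ Connected (del (add F x y) x′ y′) (inj₁ x′) (inj₂ y′)
    bridge {x′} {y′} e conn with add-inv F x y e
    ... | inj₁ (refl , refl) = nc (Connected-mono sub conn)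
      where
      sub : del (add F x y) x y ⊆E F
      sub a b d with del-inv (add F x y) x y d
      ... | g , ne with add-inv F x y g
      ...   | inj₁ eq = contradiction eq ne
      ...   | inj₂ f = f
    ... | inj₂ e′ = split (Connected-add⁻ F′ x y (Connected-mono sub conn))
      where
      F′ : EdgeSet m n
      F′ = del F x′ y′
      up : ∀ {u v} → Connected F′ u v → Connected F u v
      up = Connected-mono (λ _ _ d → proj₁ (del-inv F x′ y′ d))
      sub : del (add F x y) x′ y′ ⊆E add F′ x y
      sub a b d with del-inv (add F x y) x′ y′ d
      ... | g , ne with add-inv F x y g
      ...   | inj₁ (refl , refl) = add-edge F′ x y
      ...   | inj₂ f = add-⊇ F′ x y a b (del-edge F x′ y′ f ne)
      split : ¬ (Connected F′ (inj₁ x′) (inj₂ y′)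
                 ⊎ (Connected F′ (inj₁ x′) (inj₁ x) × Connected F′ (inj₂ y) (inj₂ y′))
                 ⊎ (Connected F′ (inj₁ x′) (inj₂ y) × Connected F′ (inj₁ x) (inj₂ y′)))
      split (inj₁ r) = acyclic⇒bridge ac e′ r
      -- The detour from x to y runs along `r` backwards to x′, over the old edge, and along `s`
      -- backwards from y′.
      split (inj₂ (inj₁ (r , s))) =
        nc (Connected-sym (up r) ◅◅ xy e′ ◅ Connected-sym (up s))
      split (inj₂ (inj₂ (r , s))) =
        nc (up s ◅◅ yx e′ ◅ up r)

-- Labelling the components

Represents : ∀ {k} → EdgeSet m n → (V m n → Fin k) → Set
Represents F c = ∀ u v → (c u ≡ c v) ⇔ Connected F u v

-- The label `j` is emptied into `i` but remains an element of `Fin k`.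
relabel : ∀ {k} → Fin k → Fin k → Fin k → Fin k
relabel i j l with l ≟ j
... | yes _ = i
... | no _ = l

module _ {k} {F : EdgeSet m n} {c : V m n → Fin k} (rep : Represents F c) where

  open module Rep {u} {v} = Equivalence (rep u v)

  Represents-add : ∀ x y → Represents (add F x y) (relabel (c (inj₁ x)) (c (inj₂ y)) ∘ c)
  Represents-add x y u v = mk⇔ to′ from′
    where
    i = c (inj₁ x)
    j = c (inj₂ y)
    up : ∀ {p q} → c p ≡ c q → Connected (add F x y) p q
    up = Connected-mono (add-⊇ F x y) ∘ to
    bridge : Connected (add F x y) (inj₁ x) (inj₂ y)
    bridge = xy (add-edge F x y) ◅ ε
    to′ : relabel i j (c u) ≡ relabel i j (c v) → Connected (add F x y) u v
    to′ eq with c u ≟ j | c v ≟ j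
    ... | yes p | yes q = up (trans p (sym q))
    ... | yes p | no _ = up p ◅◅ Connected-sym bridge ◅◅ up eq
    ... | no _ | yes q = up eq ◅◅ bridge ◅◅ up (sym q)
    ... | no _ | no _ = up eq
    relabel-cong : ∀ {p q} → c p ≡ c q → relabel i j (c p) ≡ relabel i j (c q)
    relabel-cong {p} {q} eq with c p ≟ j | c q ≟ j
    ... | yes _ | yes _ = refl
    ... | yes r | no s = contradiction (trans (sym eq) r) s
    ... | no r | yes s = contradiction (trans eq s) r
    ... | no _ | no _ = eq
    relabel-ends : relabel i j (c (inj₁ x)) ≡ relabel i j (c (inj₂ y))
    relabel-ends with c (inj₁ x) ≟ j | c (inj₂ y) ≟ j
    ... | _ | no ne = contradiction refl ne
    ... | yes _ | yes _ = refl
    ... | no _ | yes _ = refl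
    from′ : Connected (add F x y) u v → relabel i j (c u) ≡ relabel i j (c v)
    from′ conn with Connected-add⁻ F x y conn
    ... | inj₁ r = relabel-cong (from r)
    ... | inj₂ (inj₁ (r , s)) = trans (relabel-cong (from r)) (trans relabel-ends (relabel-cong (from s)))
    ... | inj₂ (inj₂ (r , s)) = trans (relabel-cong (from r)) (trans (sym relabel-ends) (relabel-cong (from s)))

-- A connection of x and y in F would survive in T without xy, although every edge of T is a bridge.
-- So each edge that a tree has outside F merges two components.
tree-edge-joins : {F T : EdgeSet m n} → F ⊆E T → IsSpanningTree T → ∀ {x y} →
                  HasEdge T x y → ¬ HasEdge F x y → ¬ Connected F (inj₁ x) (inj₂ y)
tree-edge-joins {F = F} {T} sub (_ , ac) {x} {y} e ne conn =
  acyclic⇒bridge ac e (Connected-mono avoids conn)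
  where
  avoids : F ⊆E del T x y
  avoids x′ y′ f = del-edge T x y (sub x′ y′ f) λ { (refl , refl) → ne f }

-- Finite sums and the recurrence

module Replace {a ℓ} (M : CommutativeMonoid a ℓ) where

  open CommutativeMonoid M renaming (ε to 0#; refl to ≈-refl; sym to ≈-sym; trans to ≈-trans)
  open import Algebra.Properties.CommutativeMonoid.Sum M renaming (sum to ∑)
  open import Algebra.Properties.CommutativeSemigroup commutativeSemigroup using (x∙yz≈y∙xz)
  open import Relation.Binary.Reasoning.Setoid setoid

  -- The exchanged entries stand crosswise, so nothing has to be subtracted or divided; the same
  -- lemma thus serves sums in ℚ and both sums and products in ℕ.
  sum-replace : ∀ {k} {f g : Fin k → Carrier} i → (∀ l → l ≢ i → f l ≈ g l) →
                g i ∙ ∑ f ≈ f i ∙ ∑ g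
  sum-replace {suc k} {f} {g} i eq = begin
    g i ∙ ∑ f                              ≈⟨ ∙-congˡ (sum-remove {i = i} f) ⟩
    g i ∙ (f i ∙ ∑ (f ∘ punchIn i))        ≈⟨ x∙yz≈y∙xz _ _ _ ⟩
    f i ∙ (g i ∙ ∑ (f ∘ punchIn i))        ≈⟨ ∙-congˡ (∙-congˡ (sum-cong-≋ (λ l → eq _ (punchInᵢ≢i i l)))) ⟩
    f i ∙ (g i ∙ ∑ (g ∘ punchIn i))        ≈⟨ ∙-congˡ (sum-remove {i = i} g) ⟨
    f i ∙ ∑ g                              ∎

  sum-replace₂ : ∀ {k} {f g : Fin k → Carrier} {i j} → i ≢ j → (∀ l → l ≢ i → l ≢ j → f l ≈ g l) →
                 (g i ∙ g j) ∙ ∑ f ≈ (f i ∙ f j) ∙ ∑ g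
  sum-replace₂ {k} {f} {g} {i} {j} i≢j eq = begin
    (g i ∙ g j) ∙ ∑ f  ≈⟨ ∙-congʳ (comm _ _) ⟩
    (g j ∙ g i) ∙ ∑ f  ≈⟨ assoc _ _ _ ⟩
    g j ∙ (g i ∙ ∑ f)  ≈⟨ ∙-congˡ (≈-trans (∙-congʳ (≈-sym hi)) (sum-replace i fh)) ⟩
    g j ∙ (f i ∙ ∑ h)  ≈⟨ x∙yz≈y∙xz _ _ _ ⟩
    f i ∙ (g j ∙ ∑ h)  ≈⟨ ∙-congˡ (≈-trans (sum-replace j hg) (∙-congʳ hj)) ⟩
    f i ∙ (f j ∙ ∑ g)  ≈⟨ assoc _ _ _ ⟨
    (f i ∙ f j) ∙ ∑ g  ∎
    where
    -- The intermediate family is already changed at `i` but not yet at `j`, so two single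
    -- replacements suffice.
    h : Fin k → Carrier
    h l with l ≟ i
    ... | yes _ = g l
    ... | no _ = f l
    hi : h i ≈ g i
    hi with i ≟ i
    ... | yes _ = ≈-refl
    ... | no ne = contradiction refl ne
    hj : h j ≈ f j
    hj with j ≟ i
    ... | yes e = contradiction (sym e) i≢j
    ... | no _ = ≈-refl
    fh : ∀ l → l ≢ i → f l ≈ h l
    fh l ne with l ≟ i
    ... | yes e = contradiction e ne
    ... | no _ = ≈-refl
    hg : ∀ l → l ≢ j → h l ≈ g l
    hg l ne with l ≟ i
    ... | yes _ = ≈-refl
    ... | no ne′ = eq l ne′ ne

  sum-indicator : ∀ {k} (i : Fin k) (h : Fin k → Carrier) →
                  ∑ (λ j → if does (i ≟ j) then h j else 0#) ≈ h i
  sum-indicator {k} i h = begin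
    ∑ f               ≈⟨ identityˡ _ ⟨
    0# ∙ ∑ f          ≈⟨ sum-replace i away ⟩
    f i ∙ ∑ {k} (λ _ → 0#)  ≈⟨ ∙-cong at-i (sum-replicate-zero k) ⟩
    h i ∙ 0#          ≈⟨ identityʳ _ ⟩
    h i               ∎
    where
    f : Fin k → Carrier
    f j = if does (i ≟ j) then h j else 0#
    away : ∀ j → j ≢ i → f j ≈ 0#
    away j ne with i ≟ j
    ... | yes e = contradiction (sym e) ne
    ... | no _ = ≈-refl
    at-i : f i ≈ h i
    at-i with i ≟ i
    ... | yes _ = ≈-refl
    ... | no ne = contradiction refl ne

module _ where

  import Data.Rational.Properties as ℚ
  open import Data.Rational using (ℚ; mkℚ; 0ℚ; 1ℚ; _+_; _*_; _-_; -_)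
  open import Data.Rational.Properties using (+-*-commutativeRing; toℚᵘ-injective; toℚᵘ-homo-+; toℚᵘ-homo-*;
    *-identityˡ; *-identityʳ; *-zeroˡ; *-zeroʳ; *-assoc; *-comm; *-inverseʳ; *-distribʳ-+; +-identityˡ; +-identityʳ)
  open import Algebra.Properties.Semiring.Sum (CommutativeRing.semiring +-*-commutativeRing)
    using (sum; sum-cong-≗; ∑-distrib-+; *-distribˡ-sum; sum-replicate-zero)

  -- Written directly in lowest terms, with denominator 1 stored as 0: then `ι 0` and `ι 1` compute
  -- to `0ℚ` and `1ℚ`, and injectivity can be read off the numerator.
  ι : ℕ → ℚ
  ι n = mkℚ (ℤ.+ n) 0 (Coprime.sym (1-coprimeTo n))

  ι-injective : ∀ {m n} → ι m ≡ ι n → m ≡ n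
  ι-injective eq with refl ← ℤ.+-injective (proj₁ (ℚ.mkℚ-injective eq)) = refl

  ι-+ : ∀ m n → ι (m ℕ.+ n) ≡ ι m + ι n
  ι-+ m n = toℚᵘ-injective (ℚᵘ.≃-trans (ℚᵘ.*≡* eq) (ℚᵘ.≃-sym (toℚᵘ-homo-+ (ι m) (ι n))))
    where
    eq : _
    eq = cong (ℤ._* ℤ.+ 1) (sym (cong₂ ℤ._+_ (ℤ.*-identityʳ (ℤ.+ m)) (ℤ.*-identityʳ (ℤ.+ n))))

  ι-* : ∀ m n → ι (m ℕ.* n) ≡ ι m * ι n
  ι-* m n = toℚᵘ-injective (ℚᵘ.≃-trans (ℚᵘ.*≡* eq) (ℚᵘ.≃-sym (toℚᵘ-homo-* (ι m) (ι n))))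
    where
    eq : _
    eq = cong (ℤ._* ℤ.+ 1) (ℤ.pos-* m n)

  ring : AlmostCommutativeRing _ _
  ring = fromCommutativeRing +-*-commutativeRing (λ x → dec⇒maybe (0ℚ ℚ.≟ x))

  open Replace (CommutativeRing.+-commutativeMonoid +-*-commutativeRing)
    using (sum-replace; sum-replace₂; sum-indicator)

  -- The diagonal is masked because an edge inside one component either belongs to F or lies in no
  -- spanning tree containing F.
  off : ∀ {k} → Fin k → (Fin k → ℚ) → Fin k → ℚ
  off i f j = if does (i ≟ j) then 0ℚ else f j

  sum-linear₂ : ∀ {k} c₁ (f₁ : Fin k → ℚ) c₂ f₂ →
                sum (λ i → c₁ * f₁ i + c₂ * f₂ i) ≡ c₁ * sum f₁ + c₂ * sum f₂
  sum-linear₂ c₁ f₁ c₂ f₂ =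
    trans (∑-distrib-+ (λ i → c₁ * f₁ i) (λ i → c₂ * f₂ i))
          (sym (cong₂ _+_ (*-distribˡ-sum c₁ f₁) (*-distribˡ-sum c₂ f₂)))

  -- Both the inner and the outer sum of `pair-sum` expand into five sums over a single index.
  sum-linear₅ : ∀ {k} c₁ (f₁ : Fin k → ℚ) c₂ f₂ c₃ f₃ c₄ f₄ c₅ f₅ →
    sum (λ i → (c₁ * f₁ i + c₂ * f₂ i) + ((c₃ * f₃ i + c₄ * f₄ i) + c₅ * f₅ i))
    ≡ (c₁ * sum f₁ + c₂ * sum f₂) + ((c₃ * sum f₃ + c₄ * sum f₄) + c₅ * sum f₅)
  sum-linear₅ c₁ f₁ c₂ f₂ c₃ f₃ c₄ f₄ c₅ f₅ =
    trans (∑-distrib-+ (λ i → c₁ * f₁ i + c₂ * f₂ i) _)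
          (cong₂ _+_ (sum-linear₂ c₁ f₁ c₂ f₂)
            (trans (∑-distrib-+ (λ i → c₃ * f₃ i + c₄ * f₄ i) _)
              (cong₂ _+_ (sum-linear₂ c₃ f₃ c₄ f₄) (sym (*-distribˡ-sum c₅ f₅)))))

  -- The total gain over all pairs of components

  module PairSum {k} (a b t : Fin k → ℚ) where

    s p q u v z z′ : ℚ
    s  = sum (λ i → a i * b i * t i)
    p  = sum (λ i → a i * t i)
    q  = sum (λ i → b i * t i)
    u  = sum (λ i → a i * a i * t i)
    v  = sum (λ i → b i * b i * t i)
    z  = sum (λ i → a i * b i * b i * t i * t i)
    z′ = sum (λ i → a i * a i * b i * t i * t i)

    -- For t = 1/w, merging the components i and j turns (Π w)(1 − s) into (Π w) · gain i j.
    gain : Fin k → Fin k → ℚ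
    gain i j = (t i + t j) * (1ℚ - s) + (a i * b i * (t i * t i) + a j * b j * (t j * t j))
               - t i * t j * (a i * b j + a j * b i)

    module _ {A B A⁻¹ B⁻¹ : ℚ}
      (sum-a : sum a ≡ A) (sum-b : sum b ≡ B) (A⁻¹A : A⁻¹ * A ≡ 1ℚ) (B⁻¹B : B⁻¹ * B ≡ 1ℚ)
      (inv-a : ∀ i → (a i * B + b i * A) * t i * a i ≡ a i)
      (inv-b : ∀ i → (a i * B + b i * A) * t i * b i ≡ b i)
      where

      open ≡-Reasoning

      Bz′+Az≡s : B * z′ + A * z ≡ s
      Bz′+Az≡s = trans
        (sym (sum-linear₂ B (λ i → a i * a i * b i * t i * t i) A (λ i → a i * b i * b i * t i * t i)))
        (sum-cong-≗ λ i →
        trans (id₁ (a i) (b i) (t i) A B) (trans (cong (_* (b i * t i)) (inv-a i)) (sym (*-assoc (a i) (b i) (t i)))))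
        where
        id₁ : ∀ a b t A B → B * (a * a * b * t * t) + A * (a * b * b * t * t) ≡ (a * B + b * A) * t * a * (b * t)
        id₁ = solve-∀ ring

      -- Insert `w t = 1` in the form `a = w t a` into Σ a = A and split w into its two summands.
      Bu+As≡A : B * u + A * s ≡ A
      Bu+As≡A = trans (sym (sum-linear₂ B (λ i → a i * a i * t i) A (λ i → a i * b i * t i))) (trans (sum-cong-≗ λ i →
        trans (id₁ (a i) (b i) (t i) A B) (inv-a i)) sum-a)
        where
        id₁ : ∀ a b t A B → B * (a * a * t) + A * (a * b * t) ≡ (a * B + b * A) * t * a
        id₁ = solve-∀ ring

      Av+Bs≡B : A * v + B * s ≡ B
      Av+Bs≡B = trans (sym (sum-linear₂ A (λ i → b i * b i * t i) B (λ i → a i * b i * t i))) (trans (sum-cong-≗ λ i →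
        trans (id₁ (a i) (b i) (t i) A B) (inv-b i)) sum-b)
        where
        id₁ : ∀ a b t A B → A * (b * b * t) + B * (a * b * t) ≡ (a * B + b * A) * t * b
        id₁ = solve-∀ ring

      -- The two preceding identities say `B * u = A * (1ℚ - s)` and `A * v = B * (1ℚ - s)`. They
      -- are multiplied, and the common factor `A * B` is cancelled with the given inverses.
      uv≡[1-s]² : u * v ≡ (1ℚ - s) * (1ℚ - s)
      uv≡[1-s]² = begin
        u * v                                                        ≡⟨ id₁ u v ⟩
        1ℚ * 1ℚ * (u * v)                                            ≡⟨ cong (_* (u * v)) (cong₂ _*_ A⁻¹A B⁻¹B) ⟨
        A⁻¹ * A * (B⁻¹ * B) * (u * v)                                ≡⟨ id₂ A⁻¹ A B⁻¹ B u v s ⟩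
        A⁻¹ * B⁻¹ * ((B * u + A * s - A * s) * (A * v + B * s - B * s))
          ≡⟨ cong (A⁻¹ * B⁻¹ *_) (cong₂ _*_ (cong (_- A * s) Bu+As≡A) (cong (_- B * s) Av+Bs≡B)) ⟩
        A⁻¹ * B⁻¹ * ((A - A * s) * (B - B * s))                      ≡⟨ id₃ A⁻¹ A B⁻¹ B s ⟩
        A⁻¹ * A * (B⁻¹ * B) * ((1ℚ - s) * (1ℚ - s))
          ≡⟨ cong (_* ((1ℚ - s) * (1ℚ - s))) (cong₂ _*_ A⁻¹A B⁻¹B) ⟩
        1ℚ * 1ℚ * ((1ℚ - s) * (1ℚ - s))                              ≡⟨ id₁ (1ℚ - s) (1ℚ - s) ⟨
        (1ℚ - s) * (1ℚ - s)                                          ∎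
        where
        id₁ : ∀ x y → x * y ≡ 1ℚ * 1ℚ * (x * y)
        id₁ = solve-∀ ring
        id₂ : ∀ A⁻¹ A B⁻¹ B u v s → A⁻¹ * A * (B⁻¹ * B) * (u * v)
              ≡ A⁻¹ * B⁻¹ * ((B * u + A * s - A * s) * (A * v + B * s - B * s))
        id₂ = solve-∀ ring
        id₃ : ∀ A⁻¹ A B⁻¹ B s → A⁻¹ * B⁻¹ * ((A - A * s) * (B - B * s))
              ≡ A⁻¹ * A * (B⁻¹ * B) * ((1ℚ - s) * (1ℚ - s))
        id₃ = solve-∀ ring

      row-sum : ∀ i → sum (λ j → b j * gain i j) ≡
        ((t i * (1ℚ - s) + a i * b i * (t i * t i)) * B + (1ℚ - s) * q)
        + ((1ℚ * z + - (t i * a i) * v) + - (t i * b i) * s)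
      row-sum i = trans
        (sum-cong-≗ λ j → id₁ (a i) (b i) (t i) (a j) (b j) (t j) s)
        (trans (sum-linear₅ (t i * (1ℚ - s) + a i * b i * (t i * t i)) b
                            (1ℚ - s) (λ j → b j * t j)
                            1ℚ (λ j → a j * b j * b j * t j * t j)
                            (- (t i * a i)) (λ j → b j * b j * t j)
                            (- (t i * b i)) (λ j → a j * b j * t j))
               (cong (λ e → ((t i * (1ℚ - s) + a i * b i * (t i * t i)) * e + (1ℚ - s) * q)
                            + ((1ℚ * z + - (t i * a i) * v) + - (t i * b i) * s)) sum-b))
        where
        id₁ : ∀ a b t a′ b′ t′ s →
          b′ * ((t + t′) * (1ℚ - s) + (a * b * (t * t) + a′ * b′ * (t′ * t′)) - t * t′ * (a * b′ + a′ * b))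
          ≡ ((t * (1ℚ - s) + a * b * (t * t)) * b′ + (1ℚ - s) * (b′ * t′))
            + ((1ℚ * (a′ * b′ * b′ * t′ * t′) + - (t * a) * (b′ * b′ * t′)) + - (t * b) * (a′ * b′ * t′))
        id₁ = solve-∀ ring

      -- The full row has a closed form, so the diagonal is first included and then subtracted. The
      -- subtracted `gain i i` is just `2 t_i (1 − s)`, since its quadratic terms in `t_i` cancel.
      row-sum-off : ∀ i → sum (λ j → b j * off i (gain i) j) ≡ sum (λ j → b j * gain i j) - b i * gain i i
      row-sum-off i = begin
        S                                ≡⟨ id₁ (b i * gain i i) S ⟩
        b i * gain i i + S - b i * gain i i
          ≡⟨ cong (_- b i * gain i i) (trans (sum-replace i agree) (cong (_+ S′) at-i)) ⟩
        0ℚ + S′ - b i * gain i i         ≡⟨ cong (_- b i * gain i i) (+-identityˡ S′) ⟩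
        S′ - b i * gain i i              ∎
        where
        S S′ : ℚ
        S  = sum (λ j → b j * off i (gain i) j)
        S′ = sum (λ j → b j * gain i j)
        id₁ : ∀ x y → y ≡ x + y - x
        id₁ = solve-∀ ring
        agree : ∀ j → j ≢ i → b j * off i (gain i) j ≡ b j * gain i j
        agree j ne with i ≟ j
        ... | yes e = contradiction (sym e) ne
        ... | no _ = refl
        at-i : b i * off i (gain i) i ≡ 0ℚ
        at-i with i ≟ i
        ... | yes _ = *-zeroʳ (b i)
        ... | no ne = contradiction refl ne

      -- After the double summation the auxiliary sums other than s occur only in the combinations
      -- `B * p + A * q`, which is Σ w t, `B * z′ + A * z` and `u * v`, and all three are known.
      pair-sum : sum (λ i → a i * sum (λ j → b j * off i (gain i) j))
                 ≡ (sum (λ i → (a i * B + b i * A) * t i) - 1ℚ) * (1ℚ - s)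
      pair-sum = begin
        sum (λ i → a i * sum (λ j → b j * off i (gain i) j))
          ≡⟨ sum-cong-≗ (λ i → trans
               (cong (a i *_) (trans (row-sum-off i) (cong (_- b i * gain i i) (row-sum i))))
               (id₁ (a i) (b i) (t i) s B q z v)) ⟩
        -- The coefficient `s - 1ℚ - 1ℚ` is -s from the last term of the row sum plus -2(1 - s) from
        -- the removed diagonal.
        sum (λ i → ((1ℚ - s) * B * (a i * t i) + B * (a i * a i * b i * t i * t i))
          + ((((1ℚ - s) * q + z) * a i + - v * (a i * a i * t i)) + (s - 1ℚ - 1ℚ) * (a i * b i * t i)))
          ≡⟨ sum-linear₅ ((1ℚ - s) * B) (λ i → a i * t i) B (λ i → a i * a i * b i * t i * t i)
                         ((1ℚ - s) * q + z) a (- v) (λ i → a i * a i * t i)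
                         (s - 1ℚ - 1ℚ) (λ i → a i * b i * t i) ⟩
        ((1ℚ - s) * B * p + B * z′) + ((((1ℚ - s) * q + z) * sum a + - v * u) + (s - 1ℚ - 1ℚ) * s)
          ≡⟨ cong (λ e → ((1ℚ - s) * B * p + B * z′)
                             + ((((1ℚ - s) * q + z) * e + - v * u) + (s - 1ℚ - 1ℚ) * s)) sum-a ⟩
        ((1ℚ - s) * B * p + B * z′) + ((((1ℚ - s) * q + z) * A + - v * u) + (s - 1ℚ - 1ℚ) * s)
          ≡⟨ id₂ s A B p q u v z z′ ⟩
        (1ℚ - s) * (B * p + A * q) + (B * z′ + A * z) - u * v + (s - 1ℚ - 1ℚ) * s
          ≡⟨ cong₂ (λ e f → (1ℚ - s) * (B * p + A * q) + e - f + (s - 1ℚ - 1ℚ) * s) Bz′+Az≡s uv≡[1-s]² ⟩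
        (1ℚ - s) * (B * p + A * q) + s - (1ℚ - s) * (1ℚ - s) + (s - 1ℚ - 1ℚ) * s
          ≡⟨ id₃ s (B * p + A * q) ⟩
        (B * p + A * q - 1ℚ) * (1ℚ - s)
          ≡⟨ cong (λ e → (e - 1ℚ) * (1ℚ - s)) (trans (sym (sum-linear₂ B (λ i → a i * t i) A (λ i → b i * t i)))
               (sum-cong-≗ λ i → id₄ (a i) (b i) (t i) A B)) ⟩
        (sum (λ i → (a i * B + b i * A) * t i) - 1ℚ) * (1ℚ - s) ∎
        where
        id₁ : ∀ a b t s B q z v →
          a * ((((t * (1ℚ - s) + a * b * (t * t)) * B + (1ℚ - s) * q)
               + ((1ℚ * z + - (t * a) * v) + - (t * b) * s))
               - b * ((t + t) * (1ℚ - s) + (a * b * (t * t) + a * b * (t * t)) - t * t * (a * b + a * b)))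
          ≡ ((1ℚ - s) * B * (a * t) + B * (a * a * b * t * t))
            + ((((1ℚ - s) * q + z) * a + - v * (a * a * t)) + (s - 1ℚ - 1ℚ) * (a * b * t))
        id₁ = solve-∀ ring
        id₂ : ∀ s A B p q u v z z′ →
          ((1ℚ - s) * B * p + B * z′) + ((((1ℚ - s) * q + z) * A + - v * u) + (s - 1ℚ - 1ℚ) * s)
          ≡ (1ℚ - s) * (B * p + A * q) + (B * z′ + A * z) - u * v + (s - 1ℚ - 1ℚ) * s
        id₂ = solve-∀ ring
        id₃ : ∀ s K → (1ℚ - s) * K + s - (1ℚ - s) * (1ℚ - s) + (s - 1ℚ - 1ℚ) * s ≡ (K - 1ℚ) * (1ℚ - s)
        id₃ = solve-∀ ring
        id₄ : ∀ a b t A B → B * (a * t) + A * (b * t) ≡ (a * B + b * A) * t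
        id₄ = solve-∀ ring

  -- Weights of labels, in ℕ and in ℚ

  module ReplaceΣ = Replace ℕ.+-0-commutativeMonoid
  module ReplaceΠ = Replace ℕ.*-1-commutativeMonoid

  sumF≡∑ : ∀ {k} (f : Fin k → ℕ) → sumF f ≡ Σℕ.sum f
  sumF≡∑ {zero} f = refl
  sumF≡∑ {suc k} f = cong (f zero ℕ.+_) (sumF≡∑ (f ∘ suc))

  prodF≡∏ : ∀ {k} (f : Fin k → ℕ) → prodF f ≡ Πℕ.sum f
  prodF≡∏ {zero} f = refl
  prodF≡∏ {suc k} f = cong (f zero ℕ.*_) (prodF≡∏ (f ∘ suc))

  ι-sum : ∀ {k} (f : Fin k → ℕ) → ι (Σℕ.sum f) ≡ sum (ι ∘ f)
  ι-sum {zero} f = refl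
  ι-sum {suc k} f = trans (ι-+ (f zero) _) (cong (ι (f zero) +_) (ι-sum (f ∘ suc)))

  -- Merging leaves one of the two labels unused.  An unused label has weight 0; with the conventions
  -- of inv, sgn and 0↦1 at 0 it contributes nothing to s, to the number of components K and to the
  -- product P of the weights.
  inv : ℕ → ℚ
  inv zero = 0ℚ
  inv (suc n) = mkℚ (ℤ.+ 1) n (1-coprimeTo (suc n))

  ι-inv : ∀ {n} → 0 < n → ι n * inv n ≡ 1ℚ
  ι-inv {suc n} _ = *-inverseʳ (ι (suc n))

  sgn : ℕ → ℕ
  sgn zero = 0
  sgn (suc _) = 1

  0↦1 : ℕ → ℕ
  0↦1 zero = 1
  0↦1 (suc n) = suc n

  sgn-pos : ∀ {n} → 0 < n → sgn n ≡ 1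
  sgn-pos {suc _} _ = refl

  0↦1-pos : ∀ {n} → 0 < n → 0↦1 n ≡ n
  0↦1-pos {suc _} _ = refl

  ι-inv-sgn : ∀ n → ι n * inv n ≡ ι (sgn n)
  ι-inv-sgn zero = *-zeroʳ (ι 0)
  ι-inv-sgn (suc n) = ι-inv {suc n} (s≤s z≤n)

  module Weights (m n : ℕ) {k} (X Y : Fin k → ℕ) where

    W : Fin k → ℕ
    W i = X i ℕ.* n ℕ.+ Y i ℕ.* m

    open PairSum (ι ∘ X) (ι ∘ Y) (inv ∘ W) public using (s; gain)

    P K : ℕ
    P = Πℕ.sum (0↦1 ∘ W)
    K = Σℕ.sum (sgn ∘ W)

    value : ℚ
    value = ι P * (1ℚ - s)

    ι-W : ∀ i → ι (W i) ≡ ι (X i) * ι n + ι (Y i) * ι m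
    ι-W i = trans (ι-+ (X i ℕ.* n) (Y i ℕ.* m)) (cong₂ _+_ (ι-* (X i) n) (ι-* (Y i) m))

    module _ (0<m : 0 < m) (0<n : 0 < n) where

      W-pos : ∀ {i} → 0 < X i ⊎ 0 < Y i → 0 < W i
      W-pos {i} (inj₁ p) = ℕ.<-≤-trans (ℕ.*-mono-< p 0<n) (ℕ.m≤m+n _ (Y i ℕ.* m))
      W-pos {i} (inj₂ p) = ℕ.<-≤-trans (ℕ.*-mono-< p 0<m) (ℕ.m≤n+m _ (X i ℕ.* n))

      module _ (sum-X : Σℕ.sum X ≡ m) (sum-Y : Σℕ.sum Y ≡ n) where

        inv-W : ∀ i x → (0 < x → 0 < W i) →
                (ι (X i) * ι n + ι (Y i) * ι m) * inv (W i) * ι x ≡ ι x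
        inv-W i zero _ = *-zeroʳ ((ι (X i) * ι n + ι (Y i) * ι m) * inv (W i))
        inv-W i (suc x) pos =
          trans (cong (_* ι (suc x)) (trans (cong (_* inv (W i)) (sym (ι-W i))) (ι-inv (pos (s≤s z≤n)))))
                (*-identityˡ (ι (suc x)))

        pair-sum : sum (λ i → ι (X i) * sum (λ j → ι (Y j) * off i (gain i) j)) ≡ (ι K - 1ℚ) * (1ℚ - s)
        pair-sum = trans
          (PairSum.pair-sum (ι ∘ X) (ι ∘ Y) (inv ∘ W) {ι m} {ι n} {inv m} {inv n}
            (trans (sym (ι-sum X)) (cong ι sum-X)) (trans (sym (ι-sum Y)) (cong ι sum-Y))
            (trans (*-comm (inv m) (ι m)) (ι-inv 0<m)) (trans (*-comm (inv n) (ι n)) (ι-inv 0<n))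
            (λ i → inv-W i (X i) (W-pos ∘ inj₁)) (λ i → inv-W i (Y i) (W-pos ∘ inj₂)))
          (cong (λ e → (e - 1ℚ) * (1ℚ - s)) (trans
            (sum-cong-≗ λ i → trans (cong (_* inv (W i)) (sym (ι-W i))) (ι-inv-sgn (W i)))
            (sym (ι-sum (sgn ∘ W)))))

    -- Each reciprocal in s cancels one factor of P, and `prodExcept` is what remains; this clears
    -- all denominators.
    ι-P-s : (∀ i → 0 < W i) → ι P * s ≡ ι (sumF (λ i → X i ℕ.* Y i ℕ.* prodExcept W i))
    ι-P-s pos = begin
      ι P * s                                              ≡⟨ *-distribˡ-sum (ι P) (λ i → ι (X i) * ι (Y i) * inv (W i)) ⟩
      sum (λ i → ι P * (ι (X i) * ι (Y i) * inv (W i)))    ≡⟨ sum-cong-≗ term ⟩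
      sum (λ i → ι (X i ℕ.* Y i ℕ.* prodExcept W i))       ≡⟨ ι-sum (λ i → X i ℕ.* Y i ℕ.* prodExcept W i) ⟨
      ι (Σℕ.sum (λ i → X i ℕ.* Y i ℕ.* prodExcept W i))    ≡⟨ cong ι (sumF≡∑ (λ i → X i ℕ.* Y i ℕ.* prodExcept W i)) ⟨
      ι (sumF (λ i → X i ℕ.* Y i ℕ.* prodExcept W i))      ∎
      where
      open ≡-Reasoning
      except : ∀ i → P ≡ W i ℕ.* prodExcept W i
      except i = begin
        P                          ≡⟨ Πℕ.sum-cong-≗ (λ j → 0↦1-pos (pos j)) ⟩
        Πℕ.sum W                   ≡⟨ ℕ.*-identityˡ _ ⟨
        1 ℕ.* Πℕ.sum W             ≡⟨ cong (ℕ._* Πℕ.sum W) at-i ⟨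
        g i ℕ.* Πℕ.sum W           ≡⟨ ReplaceΠ.sum-replace i agree ⟩
        W i ℕ.* Πℕ.sum g           ≡⟨ cong (W i ℕ.*_) (prodF≡∏ g) ⟨
        W i ℕ.* prodExcept W i     ∎
        where
        g : Fin k → ℕ
        g j = if does (i ≟ j) then 1 else W j
        at-i : g i ≡ 1
        at-i with i ≟ i
        ... | yes _ = refl
        ... | no ne = contradiction refl ne
        agree : ∀ l → l ≢ i → W l ≡ g l
        agree l ne with i ≟ l
        ... | yes e = contradiction (sym e) ne
        ... | no _ = refl
      id₁ : ∀ w p x y t → w * p * (x * y * t) ≡ x * y * p * (w * t)
      id₁ = solve-∀ ring
      term : ∀ i → ι P * (ι (X i) * ι (Y i) * inv (W i)) ≡ ι (X i ℕ.* Y i ℕ.* prodExcept W i)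
      term i = begin
        ι P * (ι (X i) * ι (Y i) * inv (W i))
          ≡⟨ cong (λ e → e * (ι (X i) * ι (Y i) * inv (W i))) (trans (cong ι (except i)) (ι-* (W i) _)) ⟩
        ι (W i) * ι (prodExcept W i) * (ι (X i) * ι (Y i) * inv (W i))
          ≡⟨ id₁ (ι (W i)) (ι (prodExcept W i)) (ι (X i)) (ι (Y i)) (inv (W i)) ⟩
        ι (X i) * ι (Y i) * ι (prodExcept W i) * (ι (W i) * inv (W i))
          ≡⟨ cong (ι (X i) * ι (Y i) * ι (prodExcept W i) *_) (ι-inv (pos i)) ⟩
        ι (X i) * ι (Y i) * ι (prodExcept W i) * 1ℚ
          ≡⟨ *-identityʳ _ ⟩
        ι (X i) * ι (Y i) * ι (prodExcept W i)
          ≡⟨ trans (ι-* (X i ℕ.* Y i) (prodExcept W i)) (cong (_* ι (prodExcept W i)) (ι-* (X i) (Y i))) ⟨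
        ι (X i ℕ.* Y i ℕ.* prodExcept W i) ∎

    -- Moving `ι P * s` to the other side removes the subtraction, so the equation descends to ℕ.
    value-all-alive : (∀ i → 0 < W i) → ∀ {M} → ι M ≡ value →
      M ℕ.+ sumF (λ i → X i ℕ.* Y i ℕ.* prodExcept W i) ≡ prodF W
    value-all-alive pos {M} eq = ι-injective (begin
      ι (M ℕ.+ S)                  ≡⟨ ι-+ M S ⟩
      ι M + ι S                    ≡⟨ cong₂ _+_ eq (sym (ι-P-s pos)) ⟩
      ι P * (1ℚ - s) + ι P * s     ≡⟨ id₁ (ι P) s ⟩
      ι P                          ≡⟨ cong ι (trans (Πℕ.sum-cong-≗ (λ j → 0↦1-pos (pos j))) (sym (prodF≡∏ W))) ⟩
      ι (prodF W)                  ∎)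
      where
      open ≡-Reasoning
      S : ℕ
      S = sumF (λ i → X i ℕ.* Y i ℕ.* prodExcept W i)
      id₁ : ∀ P s → P * (1ℚ - s) + P * s ≡ P
      id₁ = solve-∀ ring

    module _ {i} (X₀ : ∀ l → l ≢ i → X l ≡ 0) (Y₀ : ∀ l → l ≢ i → Y l ≡ 0) where

      W₀ : ∀ l → l ≢ i → W l ≡ 0
      W₀ l ne = cong₂ (λ x y → x ℕ.* n ℕ.+ y ℕ.* m) (X₀ l ne) (Y₀ l ne)

      K-single : 0 < W i → K ≡ 1
      K-single pos = begin
        K                          ≡⟨ ReplaceΣ.sum-replace i (λ l ne → cong sgn (W₀ l ne)) ⟩
        sgn (W i) ℕ.+ Σℕ.sum {k} (λ _ → 0)
                                   ≡⟨ cong₂ ℕ._+_ (sgn-pos pos) (Σℕ.sum-replicate-zero k) ⟩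
        1                          ∎
        where open ≡-Reasoning

      -- The only used label has weight 2mn, so s is 1/2 and the value is 2mn(1 - 1/2), which
      -- corresponds to exactly one tree.
      value-single : 0 < m → 0 < n → X i ≡ m → Y i ≡ n → ι (m ℕ.* n) ≡ value
      value-single 0<m 0<n Xi Yi = begin
        ι (m ℕ.* n)                  ≡⟨ ι-* m n ⟩
        ι m * ι n                    ≡⟨ id₁ (ι m) (ι n) ⟩
        ι m * ι n + ι n * ι m - ι m * ι n * 1ℚ
          ≡⟨ cong₂ (λ e f → e - ι m * ι n * f) ιw (ι-inv pos) ⟨
        ι w - ι m * ι n * (ι w * inv w)
          ≡⟨ id₂ (ι w) (ι m) (ι n) (inv w) ⟩
        ι w * (1ℚ - ι m * ι n * inv w)
          ≡⟨ cong₂ (λ e f → ι e * (1ℚ - f)) P≡ s≡ ⟨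
        ι P * (1ℚ - s)               ∎
        where
        open ≡-Reasoning
        w : ℕ
        w = m ℕ.* n ℕ.+ n ℕ.* m
        Wi : W i ≡ w
        Wi = cong₂ (λ x y → x ℕ.* n ℕ.+ y ℕ.* m) Xi Yi
        ιw : ι w ≡ ι m * ι n + ι n * ι m
        ιw = trans (ι-+ (m ℕ.* n) (n ℕ.* m)) (cong₂ _+_ (ι-* m n) (ι-* n m))
        pos : 0 < w
        pos = ℕ.<-≤-trans (ℕ.*-mono-< 0<m 0<n) (ℕ.m≤m+n (m ℕ.* n) (n ℕ.* m))
        P≡ : P ≡ w
        P≡ = begin
          P              ≡⟨ ℕ.*-identityˡ P ⟨
          1 ℕ.* P        ≡⟨ ReplaceΠ.sum-replace i (λ l ne → cong 0↦1 (W₀ l ne)) ⟩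
          0↦1 (W i) ℕ.* Πℕ.sum {k} (λ _ → 1)
                         ≡⟨ cong₂ ℕ._*_ (trans (cong 0↦1 Wi) (0↦1-pos pos)) (Πℕ.sum-replicate-zero k) ⟩
          w ℕ.* 1        ≡⟨ ℕ.*-identityʳ w ⟩
          w              ∎
        s≡ : s ≡ ι m * ι n * inv w
        s≡ = begin
          s              ≡⟨ +-identityˡ s ⟨
          0ℚ + s         ≡⟨ sum-replace i (λ l ne → trans
                              (cong (λ x → ι x * ι (Y l) * inv (W l)) (X₀ l ne))
                              (trans (*-assoc (ι 0) (ι (Y l)) (inv (W l))) (*-zeroˡ (ι (Y l) * inv (W l))))) ⟩
          ι (X i) * ι (Y i) * inv (W i) + sum {k} (λ _ → 0ℚ)
                         ≡⟨ cong₂ _+_ (cong₂ _*_ (cong₂ (λ x y → ι x * ι y) Xi Yi) (cong inv Wi))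
                                      (sum-replicate-zero k) ⟩
          ι m * ι n * inv w + 0ℚ  ≡⟨ +-identityʳ _ ⟩
          ι m * ι n * inv w       ∎
        id₁ : ∀ m n → m * n ≡ m * n + n * m - m * n * 1ℚ
        id₁ = solve-∀ ring
        id₂ : ∀ w m n t → w - m * n * (w * t) ≡ w * (1ℚ - m * n * t)
        id₂ = solve-∀ ring

  -- The effect of merging two labels

  record Merged {k} (i j : Fin k) (f f′ : Fin k → ℕ) : Set where
    field
      at-i : f′ i ≡ f i ℕ.+ f j
      at-j : f′ j ≡ 0
      elsewhere : ∀ l → l ≢ i → l ≢ j → f′ l ≡ f l

  module _ (m n : ℕ) {k} {X Y X′ Y′ : Fin k → ℕ} {i j : Fin k} (i≢j : i ≢ j)
    (mX : Merged i j X X′) (mY : Merged i j Y Y′) where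

    private
      module M = Weights m n X Y
      module M′ = Weights m n X′ Y′
      module mX = Merged mX
      module mY = Merged mY

    Merged-W : Merged i j M.W M′.W
    Merged-W = record
      { at-i = trans (cong₂ (λ x y → x ℕ.* n ℕ.+ y ℕ.* m) mX.at-i mY.at-i)
                     (regroup (X i) (X j) (Y i) (Y j) m n)
      ; at-j = cong₂ (λ x y → x ℕ.* n ℕ.+ y ℕ.* m) mX.at-j mY.at-j
      ; elsewhere = λ l ni nj → cong₂ (λ x y → x ℕ.* n ℕ.+ y ℕ.* m) (mX.elsewhere l ni nj) (mY.elsewhere l ni nj)
      }
      where
      regroup : ∀ x x′ y y′ m n → (x ℕ.+ x′) ℕ.* n ℕ.+ (y ℕ.+ y′) ℕ.* m
                ≡ (x ℕ.* n ℕ.+ y ℕ.* m) ℕ.+ (x′ ℕ.* n ℕ.+ y′ ℕ.* m)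
      regroup = ℕ-solve-∀

    private module mW = Merged Merged-W

    module _ (Wi : 0 < M.W i) (Wj : 0 < M.W j) where

      Wij : 0 < M.W i ℕ.+ M.W j
      Wij = ℕ.<-≤-trans Wi (ℕ.m≤m+n _ _)

      K-merge : suc M′.K ≡ M.K
      K-merge = ℕ.suc-injective (begin
        2 ℕ.+ M′.K                             ≡⟨ cong₂ (λ e f → e ℕ.+ f ℕ.+ M′.K) (sgn-pos Wi) (sgn-pos Wj) ⟨
        sgn (M.W i) ℕ.+ sgn (M.W j) ℕ.+ M′.K   ≡⟨ ReplaceΣ.sum-replace₂ i≢j (λ l ni nj → cong sgn (mW.elsewhere l ni nj)) ⟩
        sgn (M′.W i) ℕ.+ sgn (M′.W j) ℕ.+ M.K
          ≡⟨ cong₂ (λ e f → e ℕ.+ f ℕ.+ M.K) (trans (cong sgn mW.at-i) (sgn-pos Wij)) (cong sgn mW.at-j) ⟩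
        1 ℕ.+ M.K                              ∎)
        where open ≡-Reasoning

      private
        a b t : Fin k → ℚ
        a = ι ∘ X
        b = ι ∘ Y
        t = inv ∘ M.W
        wᵢ wⱼ tᵢⱼ : ℚ
        wᵢ = ι (M.W i)
        wⱼ = ι (M.W j)
        tᵢⱼ = inv (M.W i ℕ.+ M.W j)

      -- The factors `w_i` and `w_j` are replaced by `w_i + w_j` and, for the emptied label, 1; the
      -- quotient `(w_i + w_j) / (w_i w_j)` is the sum of the reciprocals.
      P-merge : ι M′.P ≡ ι M.P * (t i + t j)
      P-merge = begin
        ι M′.P                                 ≡⟨ id₁ (ι M′.P) ⟩
        1ℚ * 1ℚ * ι M′.P                       ≡⟨ cong₂ (λ e f → e * f * ι M′.P) (ι-inv Wi) (ι-inv Wj) ⟨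
        wᵢ * t i * (wⱼ * t j) * ι M′.P         ≡⟨ id₂ wᵢ wⱼ (t i) (t j) (ι M′.P) ⟩
        t i * t j * (wᵢ * wⱼ * ι M′.P)         ≡⟨ cong (t i * t j *_) replaced ⟩
        t i * t j * ((wᵢ + wⱼ) * ι M.P)        ≡⟨ id₃ wᵢ wⱼ (t i) (t j) (ι M.P) ⟩
        ι M.P * (wᵢ * t i * t j + wⱼ * t j * t i)
          ≡⟨ cong₂ (λ e f → ι M.P * (e * t j + f * t i)) (ι-inv Wi) (ι-inv Wj) ⟩
        ι M.P * (1ℚ * t j + 1ℚ * t i)          ≡⟨ id₄ (ι M.P) (t i) (t j) ⟩
        ι M.P * (t i + t j)                    ∎
        where
        open ≡-Reasoning
        replacedℕ : M.W i ℕ.* M.W j ℕ.* M′.P ≡ (M.W i ℕ.+ M.W j) ℕ.* M.P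
        replacedℕ = begin
          M.W i ℕ.* M.W j ℕ.* M′.P
            ≡⟨ cong₂ (λ e f → e ℕ.* f ℕ.* M′.P) (0↦1-pos Wi) (0↦1-pos Wj) ⟨
          0↦1 (M.W i) ℕ.* 0↦1 (M.W j) ℕ.* M′.P
            ≡⟨ ReplaceΠ.sum-replace₂ i≢j (λ l ni nj → cong 0↦1 (mW.elsewhere l ni nj)) ⟩
          0↦1 (M′.W i) ℕ.* 0↦1 (M′.W j) ℕ.* M.P
            ≡⟨ cong₂ (λ e f → e ℕ.* f ℕ.* M.P) (trans (cong 0↦1 mW.at-i) (0↦1-pos Wij)) (cong 0↦1 mW.at-j) ⟩
          (M.W i ℕ.+ M.W j) ℕ.* 1 ℕ.* M.P
            ≡⟨ cong (ℕ._* M.P) (ℕ.*-identityʳ (M.W i ℕ.+ M.W j)) ⟩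
          (M.W i ℕ.+ M.W j) ℕ.* M.P ∎
        replaced : wᵢ * wⱼ * ι M′.P ≡ (wᵢ + wⱼ) * ι M.P
        replaced = begin
          wᵢ * wⱼ * ι M′.P                  ≡⟨ trans (ι-* (M.W i ℕ.* M.W j) M′.P) (cong (_* ι M′.P) (ι-* (M.W i) (M.W j))) ⟨
          ι (M.W i ℕ.* M.W j ℕ.* M′.P)      ≡⟨ cong ι replacedℕ ⟩
          ι ((M.W i ℕ.+ M.W j) ℕ.* M.P)     ≡⟨ trans (ι-* (M.W i ℕ.+ M.W j) M.P) (cong (_* ι M.P) (ι-+ (M.W i) (M.W j))) ⟩
          (wᵢ + wⱼ) * ι M.P                 ∎
        id₁ : ∀ p → p ≡ 1ℚ * 1ℚ * p
        id₁ = solve-∀ ring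
        id₂ : ∀ w w′ t t′ p → w * t * (w′ * t′) * p ≡ t * t′ * (w * w′ * p)
        id₂ = solve-∀ ring
        id₃ : ∀ w w′ t t′ p → t * t′ * ((w + w′) * p) ≡ p * (w * t * t′ + w′ * t′ * t)
        id₃ = solve-∀ ring
        id₄ : ∀ p t t′ → p * (1ℚ * t′ + 1ℚ * t) ≡ p * (t + t′)
        id₄ = solve-∀ ring

      s-merge : a i * b i * t i + a j * b j * t j + M′.s ≡ (a i + a j) * (b i + b j) * tᵢⱼ + M.s
      s-merge = begin
        a i * b i * t i + a j * b j * t j + M′.s
          ≡⟨ sum-replace₂ i≢j (λ l ni nj → cong₂ _*_
               (cong₂ (λ x y → ι x * ι y) (mX.elsewhere l ni nj) (mY.elsewhere l ni nj))
               (cong inv (mW.elsewhere l ni nj))) ⟩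
        f i + f j + M.s
          ≡⟨ cong₂ (λ e g → e + g + M.s) at-i at-j ⟩
        (a i + a j) * (b i + b j) * tᵢⱼ + 0ℚ + M.s
          ≡⟨ cong (_+ M.s) (+-identityʳ ((a i + a j) * (b i + b j) * tᵢⱼ)) ⟩
        (a i + a j) * (b i + b j) * tᵢⱼ + M.s ∎
        where
        open ≡-Reasoning
        f : Fin k → ℚ
        f l = ι (X′ l) * ι (Y′ l) * inv (M′.W l)
        at-i : f i ≡ (a i + a j) * (b i + b j) * tᵢⱼ
        at-i = cong₂ _*_ (cong₂ _*_ (trans (cong ι mX.at-i) (ι-+ (X i) (X j)))
                                    (trans (cong ι mY.at-i) (ι-+ (Y i) (Y j))))
                         (cong inv mW.at-i)
        at-j : f j ≡ 0ℚ
        at-j = trans (cong (ι (X′ j) * ι (Y′ j) *_) (cong inv mW.at-j)) (*-zeroʳ (ι (X′ j) * ι (Y′ j)))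

      -- This removes the reciprocal of the merged weight. Without it the gain would not be a
      -- polynomial in the data of i and of j, and the sum over pairs would not split into sums over
      -- single indices.
      t-merge : (t i + t j) * tᵢⱼ ≡ t i * t j
      t-merge = begin
        (t i + t j) * tᵢⱼ                                  ≡⟨ id₁ (t i) (t j) tᵢⱼ ⟩
        (t i * 1ℚ + t j * 1ℚ) * tᵢⱼ                        ≡⟨ cong₂ (λ e f → (t i * e + t j * f) * tᵢⱼ) (ι-inv Wj) (ι-inv Wi) ⟨
        (t i * (wⱼ * t j) + t j * (wᵢ * t i)) * tᵢⱼ        ≡⟨ id₂ wᵢ wⱼ (t i) (t j) tᵢⱼ ⟩
        t i * t j * ((wᵢ + wⱼ) * tᵢⱼ)                      ≡⟨ cong (λ e → t i * t j * (e * tᵢⱼ)) (ι-+ (M.W i) (M.W j)) ⟨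
        t i * t j * (ι (M.W i ℕ.+ M.W j) * tᵢⱼ)            ≡⟨ cong (t i * t j *_) (ι-inv Wij) ⟩
        t i * t j * 1ℚ                                     ≡⟨ *-identityʳ (t i * t j) ⟩
        t i * t j                                          ∎
        where
        open ≡-Reasoning
        id₁ : ∀ t t′ u → (t + t′) * u ≡ (t * 1ℚ + t′ * 1ℚ) * u
        id₁ = solve-∀ ring
        id₂ : ∀ w w′ t t′ u → (t * (w′ * t′) + t′ * (w * t)) * u ≡ t * t′ * ((w + w′) * u)
        id₂ = solve-∀ ring

      value-merge : M′.value ≡ ι M.P * M.gain i j
      value-merge = begin
        ι M′.P * (1ℚ - M′.s)
          -- The old contributions of i and j to s are added and subtracted, to match the left side
          -- of `s-merge`.
          ≡⟨ id₁ (ι M′.P) (a i * b i * t i + a j * b j * t j) M′.s ⟩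
        ι M′.P * (1ℚ - (a i * b i * t i + a j * b j * t j + M′.s) + (a i * b i * t i + a j * b j * t j))
          ≡⟨ cong₂ (λ e f → e * (1ℚ - f + (a i * b i * t i + a j * b j * t j))) P-merge s-merge ⟩
        ι M.P * (t i + t j) * (1ℚ - ((a i + a j) * (b i + b j) * tᵢⱼ + M.s) + (a i * b i * t i + a j * b j * t j))
          ≡⟨ id₂ (ι M.P) (a i) (a j) (b i) (b j) (t i) (t j) tᵢⱼ M.s ⟩
        ι M.P * ((t i + t j) * (1ℚ - M.s + (a i * b i * t i + a j * b j * t j)) - (a i + a j) * (b i + b j) * ((t i + t j) * tᵢⱼ))
          ≡⟨ cong (λ e → ι M.P * ((t i + t j) * (1ℚ - M.s + (a i * b i * t i + a j * b j * t j)) - (a i + a j) * (b i + b j) * e)) t-merge ⟩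
        ι M.P * ((t i + t j) * (1ℚ - M.s + (a i * b i * t i + a j * b j * t j)) - (a i + a j) * (b i + b j) * (t i * t j))
          ≡⟨ id₃ (ι M.P) (a i) (a j) (b i) (b j) (t i) (t j) M.s ⟩
        ι M.P * M.gain i j ∎
        where
        open ≡-Reasoning
        id₁ : ∀ p x s → p * (1ℚ - s) ≡ p * (1ℚ - (x + s) + x)
        id₁ = solve-∀ ring
        id₂ : ∀ p a a′ b b′ t t′ u s →
          p * (t + t′) * (1ℚ - ((a + a′) * (b + b′) * u + s) + (a * b * t + a′ * b′ * t′))
          ≡ p * ((t + t′) * (1ℚ - s + (a * b * t + a′ * b′ * t′)) - (a + a′) * (b + b′) * ((t + t′) * u))
        id₂ = solve-∀ ring
        id₃ : ∀ p a a′ b b′ t t′ s →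
          p * ((t + t′) * (1ℚ - s + (a * b * t + a′ * b′ * t′)) - (a + a′) * (b + b′) * (t * t′))
          ≡ p * ((t + t′) * (1ℚ - s) + (a * b * (t * t) + a′ * b′ * (t′ * t′)) - t * t′ * (a * b′ + a′ * b))
        id₃ = solve-∀ ring

  -- Counting by labels and by edges

  term≤∑ : ∀ {k} (f : Fin k → ℕ) i → f i ≤ Σℕ.sum f
  term≤∑ f zero = ℕ.m≤m+n (f zero) _
  term≤∑ f (suc i) = ℕ.≤-trans (term≤∑ (f ∘ suc) i) (ℕ.m≤n+m _ (f zero))

  ∑-nonzero : ∀ {k} (f : Fin k → ℕ) → Σℕ.sum f ≢ 0 → ∃ λ i → f i ≢ 0
  ∑-nonzero {zero} f ne = contradiction refl ne
  ∑-nonzero {suc k} f ne with f zero in eq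
  ... | suc _ = zero , λ f0 → ℕ.1+n≢0 (trans (sym eq) f0)
  ... | zero with i , fi ← ∑-nonzero (f ∘ suc) ne = suc i , fi

  δ : ∀ {k} → Fin k → Fin k → ℕ
  δ i j = if does (i ≟ j) then 1 else 0

  δ-same : ∀ {k} {i j : Fin k} → i ≡ j → δ i j ≡ 1
  δ-same {i = i} {j} e with i ≟ j
  ... | yes _ = refl
  ... | no ne = contradiction e ne

  δ-diff : ∀ {k} {i j : Fin k} → i ≢ j → δ i j ≡ 0
  δ-diff {i = i} {j} ne with i ≟ j
  ... | yes e = contradiction e ne
  ... | no _ = refl

  module _ {k : ℕ} where

    countF-pos : ∀ {r} (c : Fin r → Fin k) a → 0 < countF c (c a)
    countF-pos c a = begin-strict
      0                 <⟨ s≤s z≤n ⟩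
      1                 ≡⟨ δ-same {i = c a} refl ⟨
      δ (c a) (c a)     ≤⟨ term≤∑ (λ b → δ (c b) (c a)) a ⟩
      Σℕ.sum (λ b → δ (c b) (c a))  ≡⟨ sumF≡∑ (λ b → δ (c b) (c a)) ⟨
      countF c (c a)    ∎
      where open ℕ.≤-Reasoning

    countF-zero : ∀ {r} (c : Fin r → Fin k) {i} → (∀ a → c a ≢ i) → countF c i ≡ 0
    countF-zero {zero} c ne = refl
    countF-zero {suc r} c ne = cong₂ ℕ._+_ (δ-diff (ne zero)) (countF-zero (c ∘ suc) (ne ∘ suc))

    countF-const : ∀ {r} (c : Fin r → Fin k) {i} → (∀ a → c a ≡ i) → countF c i ≡ r
    countF-const {zero} c eq = refl
    countF-const {suc r} c eq = cong₂ ℕ._+_ (δ-same (eq zero)) (countF-const (c ∘ suc) (eq ∘ suc))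

    ∑-countF : ∀ {r} (c : Fin r → Fin k) → Σℕ.sum (countF c) ≡ r
    ∑-countF {zero} c = Σℕ.sum-replicate-zero k
    ∑-countF {suc r} c = trans (Σℕ.∑-distrib-+ (δ (c zero)) (countF (c ∘ suc)))
      (cong₂ ℕ._+_ (ReplaceΣ.sum-indicator (c zero) (λ _ → 1)) (∑-countF (c ∘ suc)))

    -- Used once for X and once for Y, this turns a sum over vertex pairs xy into one over label
    -- pairs with coefficients a_i b_j.
    sum-by-label : ∀ {r} (c : Fin r → Fin k) (h : Fin k → ℚ) →
                   sum (λ a → h (c a)) ≡ sum (λ i → ι (countF c i) * h i)
    sum-by-label {zero} c h =
      sym (trans (sum-cong-≗ λ i → *-zeroˡ (h i)) (sum-replicate-zero k))
    sum-by-label {suc r} c h = begin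
      h (c zero) + sum (λ a → h (c (suc a)))
        ≡⟨ cong₂ _+_ (sym (sum-indicator (c zero) h)) (sum-by-label (c ∘ suc) h) ⟩
      sum (λ i → if does (c zero ≟ i) then h i else 0ℚ) + sum (λ i → ι (countF (c ∘ suc) i) * h i)
        ≡⟨ ∑-distrib-+ (λ i → if does (c zero ≟ i) then h i else 0ℚ) (λ i → ι (countF (c ∘ suc) i) * h i) ⟨
      sum (λ i → (if does (c zero ≟ i) then h i else 0ℚ) + ι (countF (c ∘ suc) i) * h i)
        ≡⟨ sum-cong-≗ term ⟩
      sum (λ i → ι (countF c i) * h i) ∎
      where
      open ≡-Reasoning
      pull : ∀ i → (if does (c zero ≟ i) then h i else 0ℚ) ≡ ι (δ (c zero) i) * h i
      pull i with c zero ≟ i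
      ... | yes _ = sym (*-identityˡ (h i))
      ... | no _ = sym (*-zeroˡ (h i))
      term : ∀ i → (if does (c zero ≟ i) then h i else 0ℚ) + ι (countF (c ∘ suc) i) * h i ≡ ι (countF c i) * h i
      term i = begin
        (if does (c zero ≟ i) then h i else 0ℚ) + ι (countF (c ∘ suc) i) * h i
          ≡⟨ cong (_+ ι (countF (c ∘ suc) i) * h i) (pull i) ⟩
        ι (δ (c zero) i) * h i + ι (countF (c ∘ suc) i) * h i
          ≡⟨ *-distribʳ-+ (h i) (ι (δ (c zero) i)) (ι (countF (c ∘ suc) i)) ⟨
        (ι (δ (c zero) i) + ι (countF (c ∘ suc) i)) * h i
          ≡⟨ cong (_* h i) (ι-+ (δ (c zero) i) (countF (c ∘ suc) i)) ⟨
        ι (countF c i) * h i ∎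

    module _ {i j : Fin k} (i≢j : i ≢ j) where

      relabel-i : ∀ l → δ (relabel i j l) i ≡ δ l i ℕ.+ δ l j
      relabel-i l with l ≟ j
      ... | yes refl = trans (δ-same {i = i} refl) (sym (cong₂ ℕ._+_ (δ-diff (i≢j ∘ sym)) refl))
      ... | no _ = sym (ℕ.+-identityʳ (δ l i))

      relabel-j : ∀ l → relabel i j l ≢ j
      relabel-j l with l ≟ j
      ... | yes _ = i≢j
      ... | no ne = ne

      relabel-other : ∀ l {o} → o ≢ i → o ≢ j → δ (relabel i j l) o ≡ δ l o
      relabel-other l oi oj with l ≟ j
      ... | yes refl = trans (δ-diff (oi ∘ sym)) (sym (δ-diff (oj ∘ sym)))
      ... | no _ = refl

      countF-relabel : ∀ {r} (c : Fin r → Fin k) → Merged i j (countF c) (countF (relabel i j ∘ c))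
      countF-relabel c = record
        { at-i = begin
            countF (relabel i j ∘ c) i                      ≡⟨ sumF≡∑ (λ a → δ (relabel i j (c a)) i) ⟩
            Σℕ.sum (λ a → δ (relabel i j (c a)) i)          ≡⟨ Σℕ.sum-cong-≗ (relabel-i ∘ c) ⟩
            Σℕ.sum (λ a → δ (c a) i ℕ.+ δ (c a) j)          ≡⟨ Σℕ.∑-distrib-+ (λ a → δ (c a) i) (λ a → δ (c a) j) ⟩
            Σℕ.sum (λ a → δ (c a) i) ℕ.+ Σℕ.sum (λ a → δ (c a) j)
                                                            ≡⟨ cong₂ ℕ._+_ (sumF≡∑ (λ a → δ (c a) i)) (sumF≡∑ (λ a → δ (c a) j)) ⟨
            countF c i ℕ.+ countF c j                       ∎
        ; at-j = countF-zero (relabel i j ∘ c) (relabel-j ∘ c)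
        ; elsewhere = λ o oi oj → begin
            countF (relabel i j ∘ c) o               ≡⟨ sumF≡∑ (λ a → δ (relabel i j (c a)) o) ⟩
            Σℕ.sum (λ a → δ (relabel i j (c a)) o)   ≡⟨ Σℕ.sum-cong-≗ (λ a → relabel-other (c a) oi oj) ⟩
            Σℕ.sum (λ a → δ (c a) o)                 ≡⟨ sumF≡∑ (λ a → δ (c a) o) ⟨
            countF c o                               ∎
        }
        where open ≡-Reasoning

  module LabelWeights {m n k} (c : V m n → Fin k) = Weights m n (countF (c ∘ inj₁)) (countF (c ∘ inj₂))

  module _ {k} (c : V m n → Fin k) (0<m : 0 < m) (0<n : 0 < n) where

    private module L = LabelWeights c

    label-alive : ∀ v → 0 < L.W (c v)
    label-alive (inj₁ x) = L.W-pos 0<m 0<n (inj₁ (countF-pos (c ∘ inj₁) x))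
    label-alive (inj₂ y) = L.W-pos 0<m 0<n (inj₂ (countF-pos (c ∘ inj₂) y))

    0<K : 0 < L.K
    0<K = ℕ.<-≤-trans (subst (0 <_) (sym (sgn-pos (label-alive v))) (s≤s z≤n)) (term≤∑ (sgn ∘ L.W) (c v))
      where
      v : V m n
      v = inj₁ (fromℕ< 0<m)

    module _ {u v} (cu≢cv : c u ≢ c v) where

      private
        c′ : V m n → Fin k
        c′ = relabel (c u) (c v) ∘ c

      K-relabel : suc (LabelWeights.K c′) ≡ L.K
      K-relabel = K-merge m n cu≢cv (countF-relabel cu≢cv (c ∘ inj₁)) (countF-relabel cu≢cv (c ∘ inj₂))
                    (label-alive u) (label-alive v)

      value-relabel : LabelWeights.value c′ ≡ ι L.P * L.gain (c u) (c v)
      value-relabel = value-merge m n cu≢cv (countF-relabel cu≢cv (c ∘ inj₁)) (countF-relabel cu≢cv (c ∘ inj₂))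
                    (label-alive u) (label-alive v)

  -- Merging two distinct labels of vertices would bring K down to 0, but the label of any vertex
  -- has positive weight.
  K≡1⇒const : ∀ {k} (c : V m n → Fin k) → 0 < m → 0 < n → LabelWeights.K c ≡ 1 → ∀ u v → c u ≡ c v
  K≡1⇒const c 0<m 0<n K≡1 u v with c u ≟ c v
  ... | yes e = e
  ... | no ne = contradiction (ℕ.suc-injective (trans (K-relabel c 0<m 0<n ne) K≡1))
                  (ℕ.m<n⇒n≢0 (0<K (relabel (c u) (c v) ∘ c) 0<m 0<n))

  -- Edges of a tree outside the forest

  extraEntry : EdgeSet m n → EdgeSet m n → Fin m → Fin n → ℕ
  extraEntry F T x y =
    if lookup (lookup F x) y then 0 else (if lookup (lookup T x) y then 1 else 0)

  extra : EdgeSet m n → EdgeSet m n → ℕ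
  extra F T = Σℕ.sum λ x → Σℕ.sum λ y → extraEntry F T x y

  extra-nonzero : (F T : EdgeSet m n) → extra F T ≢ 0 → ∃₂ λ x y → HasEdge T x y × ¬ HasEdge F x y
  extra-nonzero F T ne with ∑-nonzero _ ne
  ... | x , nx with ∑-nonzero _ nx
  ...   | y , ny with lookup (lookup F x) y in eqF | lookup (lookup T x) y in eqT
  ...     | true | _ = contradiction refl ny
  ...     | false | false = contradiction refl ny
  ...     | false | true = x , y , eqT , λ f → contradiction (trans (sym eqF) f) λ ()

  extra≡0⇒⊇ : (F T : EdgeSet m n) → extra F T ≡ 0 → T ⊆E F
  extra≡0⇒⊇ F T eq x y e with lookup (lookup F x) y in eqF
  ... | true = refl
  ... | false = contradiction (ℕ.≤-trans entry (ℕ.≤-reflexive eq)) λ ()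
    where
    entry : 1 ≤ extra F T
    entry = ℕ.≤-trans (ℕ.≤-reflexive one) (ℕ.≤-trans (term≤∑ (extraEntry F T x) y) (term≤∑ _ x))
      where
      one : 1 ≡ extraEntry F T x y
      one rewrite eqF | e = refl

  extra-add : (F T : EdgeSet m n) → ∀ {x y} → HasEdge T x y → ¬ HasEdge F x y →
              extra F T ≡ suc (extra (add F x y) T)
  -- Row x of the new matrix is added on both sides because `sum-replace` compares the two totals
  -- only crosswise.
  extra-add {m} {n} F T {x} {y} e nf = ℕ.+-cancelˡ-≡ (row′ x) _ _ (begin
    row′ x ℕ.+ extra F T                  ≡⟨ ReplaceΣ.sum-replace x (λ x′ ne → Σℕ.sum-cong-≗ {n} λ y′ → same (ne ∘ proj₁)) ⟩
    row x ℕ.+ extra F′ T                  ≡⟨ cong (ℕ._+ extra F′ T) row-add ⟩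
    suc (row′ x) ℕ.+ extra F′ T           ≡⟨ ℕ.+-suc (row′ x) (extra F′ T) ⟨
    row′ x ℕ.+ suc (extra F′ T)           ∎)
    where
    open ≡-Reasoning
    F′ : EdgeSet m n
    F′ = add F x y
    row row′ : Fin m → ℕ
    row x = Σℕ.sum (extraEntry F T x)
    row′ x = Σℕ.sum (extraEntry F′ T x)
    same : ∀ {x′ y′} → ¬ (x′ ≡ x × y′ ≡ y) → extraEntry F T x′ y′ ≡ extraEntry F′ T x′ y′
    same {x′} {y′} ne = cong (λ b → if b then 0 else (if lookup (lookup T x′) y′ then 1 else 0))
                             (sym (lookup-setEdge′ true F x y ne))
    old : extraEntry F T x y ≡ 1
    old rewrite Bool.¬-not nf | e = refl
    new : extraEntry F′ T x y ≡ 0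
    new rewrite add-edge F x y = refl
    row-add : row x ≡ suc (row′ x)
    row-add = begin
      row x                                 ≡⟨ cong (ℕ._+ row x) new ⟨
      extraEntry F′ T x y ℕ.+ row x         ≡⟨ ReplaceΣ.sum-replace y (λ y′ ne → same (ne ∘ proj₂)) ⟩
      extraEntry F T x y ℕ.+ row′ x         ≡⟨ cong (ℕ._+ row′ x) old ⟩
      suc (row′ x)                          ∎

  hasEdge? : (x : Fin m) (y : Fin n) (T : EdgeSet m n) → Dec (HasEdge T x y)
  hasEdge? x y T = lookup (lookup T x) y Bool.≟ true

  withEdge : Fin m → Fin n → List (EdgeSet m n) → List (EdgeSet m n)
  withEdge x y = filter (hasEdge? x y)

  -- If `L` lists the trees containing F, then at an edge outside F this is τ of F + xy, by
  -- `TauIs-withEdge`.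
  newCount : EdgeSet m n → List (EdgeSet m n) → Fin m → Fin n → ℕ
  newCount F L x y = if lookup (lookup F x) y then 0 else length (withEdge x y L)

  ∑∑-distrib-+ : (f g : Fin m → Fin n → ℕ) →
    (Σℕ.sum λ x → Σℕ.sum λ y → f x y ℕ.+ g x y)
    ≡ (Σℕ.sum λ x → Σℕ.sum (f x)) ℕ.+ (Σℕ.sum λ x → Σℕ.sum (g x))
  ∑∑-distrib-+ f g = trans (Σℕ.sum-cong-≗ λ x → Σℕ.∑-distrib-+ (f x) (g x))
    (Σℕ.∑-distrib-+ (λ x → Σℕ.sum (f x)) (λ x → Σℕ.sum (g x)))

  -- Both sides count the pairs of a tree in `L` and an edge of it outside F, the left by edges and
  -- the right by trees.
  double-count : (F : EdgeSet m n) (L : List (EdgeSet m n)) {d : ℕ} → (∀ {T} → T ∈ L → extra F T ≡ d) →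
    (Σℕ.sum λ x → Σℕ.sum λ y → newCount F L x y) ≡ length L ℕ.* d
  double-count {m} {n} F [] eq =
    trans (Σℕ.sum-cong-≗ {m} λ x → trans (Σℕ.sum-cong-≗ (none x)) (Σℕ.sum-replicate-zero n))
          (Σℕ.sum-replicate-zero m)
    where
    none : ∀ x y → newCount F [] x y ≡ 0
    none x y with lookup (lookup F x) y
    ... | true = refl
    ... | false = refl
  double-count F (T ∷ L) eq =
    trans (Σℕ.sum-cong-≗ λ x → Σℕ.sum-cong-≗ (cons x))
    (trans (∑∑-distrib-+ (extraEntry F T) (newCount F L))
           (cong₂ ℕ._+_ (eq (here refl)) (double-count F L (eq ∘ there))))
    where
    cons : ∀ x y → newCount F (T ∷ L) x y ≡ extraEntry F T x y ℕ.+ newCount F L x y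
    cons x y with lookup (lookup F x) y
    ... | true = refl
    ... | false with lookup (lookup T x) y
    ...   | true = refl
    ...   | false = refl

  singleton-length : ∀ {A : Set} {a : A} {L : List A} → Unique L → a ∈ L → (∀ {b} → b ∈ L → b ≡ a) → length L ≡ 1
  singleton-length {L = _ ∷ []} _ _ _ = refl
  singleton-length {L = _ ∷ _ ∷ _} ((b≢c ∷ _) ∷ _) _ eq =
    contradiction (trans (eq (here refl)) (sym (eq (there (here refl))))) b≢c

  ⊆E-antisym : {F T : EdgeSet m n} → F ⊆E T → T ⊆E F → T ≡ F
  ⊆E-antisym {m} {n} {F} {T} sub sup = vec-ext λ x → vec-ext λ y → Bool.⇔→≡ (mk⇔ (sup x y) (sub x y))
    where
    vec-ext : ∀ {A : Set} {r} {xs ys : Vec A r} → (∀ i → lookup xs i ≡ lookup ys i) → xs ≡ ys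
    vec-ext eq = Pointwise-≡⇒≡ (ext eq)

  ι-*-sum : ∀ {r} c (f : Fin r → ℕ) → ι (c ℕ.* Σℕ.sum f) ≡ sum (λ i → ι (c ℕ.* f i))
  ι-*-sum c f = begin
    ι (c ℕ.* Σℕ.sum f)            ≡⟨ ι-* c (Σℕ.sum f) ⟩
    ι c * ι (Σℕ.sum f)            ≡⟨ cong (ι c *_) (ι-sum f) ⟩
    ι c * sum (ι ∘ f)             ≡⟨ *-distribˡ-sum (ι c) (ι ∘ f) ⟩
    sum (λ i → ι c * ι (f i))     ≡⟨ sum-cong-≗ (λ i → ι-* c (f i)) ⟨
    sum (λ i → ι (c ℕ.* f i))     ∎
    where open ≡-Reasoning

  -- Induction on the number of components

  module _ {k : ℕ} (0<m : 0 < m) (0<n : 0 < n) where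

    -- Move the edges of T outside F into F one by one. Each joins two components and lowers K by
    -- one; at the end F contains the connected T, so a single label is in use.
    K-of-tree : ∀ d {F : EdgeSet m n} {c : V m n → Fin k} → Represents F c →
                ∀ {T} → F ⊆E T → IsSpanningTree T → extra F T ≡ d → LabelWeights.K c ≡ suc d
    K-of-tree zero {F} {c} rep {T} sub (conn , _) eq =
      Weights.K-single m n (countF (c ∘ inj₁)) (countF (c ∘ inj₂)) {c v}
        (λ l ne → countF-zero (c ∘ inj₁) (away ne ∘ inj₁))
        (λ l ne → countF-zero (c ∘ inj₂) (away ne ∘ inj₂))
        (label-alive c 0<m 0<n v)
      where
      v : V m n
      v = inj₁ (fromℕ< 0<m)
      away : ∀ {l} → l ≢ c v → ∀ w → c w ≢ l
      away ne w refl = ne (Equivalence.from (rep w v) (Connected-mono (extra≡0⇒⊇ F T eq) (conn w v)))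
    K-of-tree (suc d) {F} {c} rep {T} sub tree eq
      with x , y , e , nf ← extra-nonzero F T (λ z → ℕ.1+n≢0 (trans (sym eq) z)) =
      trans (sym (K-relabel c 0<m 0<n (tree-edge-joins sub tree e nf ∘ Equivalence.to (rep _ _))))
        (cong suc (K-of-tree d (Represents-add rep x y) (add-least F T sub e) tree
          (ℕ.suc-injective (trans (sym (extra-add F T e nf)) eq))))

    ExtendsTo : EdgeSet m n → EdgeSet m n → Set
    ExtendsTo F T = F ⊆E T × IsSpanningTree T

    TauIs-withEdge : ∀ (F : EdgeSet m n) {L} → Unique L → (∀ T → (T ∈ L) ⇔ ExtendsTo F T) →
                     ∀ x y → TauIs (add F x y) (length (withEdge x y L))
    TauIs-withEdge F {L} uq spec x y =
      withEdge x y L , filter⁺ (hasEdge? x y) uq , (λ T → mk⇔ (to′ T) (from′ T)) , refl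
      where
      to′ : ∀ T → T ∈ withEdge x y L → ExtendsTo (add F x y) T
      to′ T T∈ with ∈-filter⁻ (hasEdge? x y) T∈
      ... | T∈L , e with sub , tree ← Equivalence.to (spec T) T∈L = add-least F T sub e , tree
      from′ : ∀ T → ExtendsTo (add F x y) T → T ∈ withEdge x y L
      from′ T (sub , tree) = ∈-filter⁺ (hasEdge? x y)
        (Equivalence.from (spec T) ((λ x′ y′ → sub x′ y′ ∘ add-⊇ F x y x′ y′) , tree))
        (sub x y (add-edge F x y))

    -- A tree edge outside F would have to join two components of F, so F itself is the only tree
    -- that contains it.
    tau-connected : ∀ {F : EdgeSet m n} {N} → Acyclic F → (∀ u v → Connected F u v) → TauIs F N → N ≡ 1
    tau-connected {F} ac conn (L , uq , spec , refl) =
      singleton-length uq (Equivalence.from (spec F) ((λ _ _ → id) , conn , ac)) only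
      where
      only : ∀ {T} → T ∈ L → T ≡ F
      only {T} T∈ with sub , tree ← Equivalence.to (spec T) T∈ = ⊆E-antisym sub T⊆F
        where
        T⊆F : T ⊆E F
        T⊆F x y e with hasEdge? x y F
        ... | yes f = f
        ... | no nf = contradiction (conn (inj₁ x) (inj₂ y)) (tree-edge-joins sub tree e nf)

    -- Forest, labelling and count are all quantified after `d`, so that the hypothesis applies to F
    -- + xy with the relabelled `c` and the length of the filtered list.
    tau-value : ∀ d {F : EdgeSet m n} {c : V m n → Fin k} → Represents F c → Acyclic F →
                LabelWeights.K c ≡ suc d → ∀ {N} → TauIs F N → ι (m ℕ.* n ℕ.* N) ≡ LabelWeights.value c
    tau-value zero {F} {c} rep ac K≡ {N} tau = begin
      ι (m ℕ.* n ℕ.* N)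
        ≡⟨ cong ι (trans (cong (m ℕ.* n ℕ.*_) (tau-connected ac (λ u v → Equivalence.to (rep u v) (const u v)) tau))
                         (ℕ.*-identityʳ (m ℕ.* n))) ⟩
      ι (m ℕ.* n)
        ≡⟨ Weights.value-single m n (countF (c ∘ inj₁)) (countF (c ∘ inj₂)) {c v}
             (λ l ne → countF-zero (c ∘ inj₁) (λ x e → ne (trans (sym e) (const (inj₁ x) v))))
             (λ l ne → countF-zero (c ∘ inj₂) (λ y e → ne (trans (sym e) (const (inj₂ y) v))))
             0<m 0<n
             (countF-const (c ∘ inj₁) (λ x → const (inj₁ x) v))
             (countF-const (c ∘ inj₂) (λ y → const (inj₂ y) v)) ⟩
      LabelWeights.value c ∎
      where
      open ≡-Reasoning
      v : V m n
      v = inj₁ (fromℕ< 0<m)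
      const : ∀ u v → c u ≡ c v
      const = K≡1⇒const c 0<m 0<n K≡
    tau-value (suc d) {F} {c} rep ac K≡ tau@(L , uq , spec , refl) = begin
      ι (mn ℕ.* length L)                ≡⟨ id₁ (ι (mn ℕ.* length L)) ⟩
      ι (mn ℕ.* length L) * 1ℚ           ≡⟨ cong (ι (mn ℕ.* length L) *_) (ι-inv {suc d} (s≤s z≤n)) ⟨
      ι (mn ℕ.* length L) * (ι (suc d) * inv (suc d))
        ≡⟨ *-assoc (ι (mn ℕ.* length L)) (ι (suc d)) (inv (suc d)) ⟨
      ι (mn ℕ.* length L) * ι (suc d) * inv (suc d)
        ≡⟨ cong (_* inv (suc d)) counted ⟩
      LW.value * ι (suc d) * inv (suc d) ≡⟨ *-assoc LW.value (ι (suc d)) (inv (suc d)) ⟩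
      LW.value * (ι (suc d) * inv (suc d))
        ≡⟨ cong (LW.value *_) (ι-inv {suc d} (s≤s z≤n)) ⟩
      LW.value * 1ℚ                      ≡⟨ *-identityʳ LW.value ⟩
      LW.value                           ∎
      where
      open ≡-Reasoning
      module LW = LabelWeights c
      mn : ℕ
      mn = m ℕ.* n
      id₁ : ∀ p → p ≡ p * 1ℚ
      id₁ = solve-∀ ring
      pairValue : Fin m → Fin n → ℚ
      pairValue x y = off (c (inj₁ x)) (LW.gain (c (inj₁ x))) (c (inj₂ y))
      entry : ∀ x y → ι (mn ℕ.* newCount F L x y) ≡ ι LW.P * pairValue x y
      entry x y with lookup (lookup F x) y in eqF | c (inj₁ x) ≟ c (inj₂ y)
      ... | true | yes _ = trans (cong ι (ℕ.*-zeroʳ mn)) (sym (*-zeroʳ (ι LW.P)))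
      ... | true | no ne = contradiction (Equivalence.from (rep (inj₁ x) (inj₂ y)) (xy eqF ◅ ε)) ne
      -- No tree in `L` contains an edge that is outside F but has both ends in one component of F.
      ... | false | yes same =
        trans (cong ι (trans (cong (mn ℕ.*_) none) (ℕ.*-zeroʳ mn))) (sym (*-zeroʳ (ι LW.P)))
        where
        none : length (withEdge x y L) ≡ 0
        none with withEdge x y L in eq
        ... | [] = refl
        ... | T ∷ _ with T∈L , e ← ∈-filter⁻ (hasEdge? x y) {xs = L} (subst (T ∈_) (sym eq) (here refl))
                    with sub , tree ← Equivalence.to (spec T) T∈L =
          contradiction (Equivalence.to (rep (inj₁ x) (inj₂ y)) same)
            (tree-edge-joins sub tree e λ f → contradiction (trans (sym eqF) f) λ ())
      ... | false | no ne = trans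
        (tau-value d (Represents-add rep x y) (acyclic-add F x y ac (ne ∘ Equivalence.from (rep _ _)))
          (ℕ.suc-injective (trans (K-relabel c 0<m 0<n ne) K≡)) (TauIs-withEdge F uq spec x y))
        (value-relabel c 0<m 0<n ne)
      counted : ι (mn ℕ.* length L) * ι (suc d) ≡ LW.value * ι (suc d)
      counted = begin
        ι (mn ℕ.* length L) * ι (suc d)
          ≡⟨ ι-* (mn ℕ.* length L) (suc d) ⟨
        ι (mn ℕ.* length L ℕ.* suc d)
          ≡⟨ cong ι (ℕ.*-assoc mn (length L) (suc d)) ⟩
        ι (mn ℕ.* (length L ℕ.* suc d))
          ≡⟨ cong (λ e → ι (mn ℕ.* e)) (double-count F L extra≡) ⟨
        ι (mn ℕ.* (Σℕ.sum λ x → Σℕ.sum (newCount F L x)))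
          ≡⟨ ι-*-sum mn (λ x → Σℕ.sum (newCount F L x)) ⟩
        sum (λ x → ι (mn ℕ.* Σℕ.sum (newCount F L x)))
          ≡⟨ sum-cong-≗ (λ x → trans (ι-*-sum mn (newCount F L x)) (sum-cong-≗ (entry x))) ⟩
        sum (λ x → sum (λ y → ι LW.P * pairValue x y))
          ≡⟨ sum-cong-≗ (λ x → sym (*-distribˡ-sum (ι LW.P) (pairValue x))) ⟩
        sum (λ x → ι LW.P * sum (pairValue x))
          ≡⟨ *-distribˡ-sum (ι LW.P) (λ x → sum (pairValue x)) ⟨
        ι LW.P * sum (λ x → sum (pairValue x))
          ≡⟨ cong (ι LW.P *_) by-label ⟩
        ι LW.P * ((ι LW.K - 1ℚ) * (1ℚ - LW.s))
          ≡⟨ cong (λ e → ι LW.P * ((e - 1ℚ) * (1ℚ - LW.s))) (trans (cong ι K≡) (ι-+ 1 (suc d))) ⟩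
        ι LW.P * ((1ℚ + ι (suc d) - 1ℚ) * (1ℚ - LW.s))
          ≡⟨ id₂ (ι LW.P) (ι (suc d)) LW.s ⟩
        LW.value * ι (suc d) ∎
        where
        id₂ : ∀ p d s → p * ((1ℚ + d - 1ℚ) * (1ℚ - s)) ≡ p * (1ℚ - s) * d
        id₂ = solve-∀ ring
        extra≡ : ∀ {T} → T ∈ L → extra F T ≡ suc d
        -- The same K is one more than the number of edges of T outside F and, by hypothesis,
        -- `suc (suc d)`.
        extra≡ {T} T∈ with sub , tree ← Equivalence.to (spec T) T∈ =
          ℕ.suc-injective (trans (sym (K-of-tree _ rep sub tree refl)) K≡)
        by-label : sum (λ x → sum (pairValue x)) ≡ (ι LW.K - 1ℚ) * (1ℚ - LW.s)
        by-label = begin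
          sum (λ x → sum (pairValue x))
            ≡⟨ sum-cong-≗ (λ x → sum-by-label (c ∘ inj₂) (off (c (inj₁ x)) (LW.gain (c (inj₁ x))))) ⟩
          sum (λ x → row (c (inj₁ x)))
            ≡⟨ sum-by-label (c ∘ inj₁) row ⟩
          sum (λ i → ι (countF (c ∘ inj₁) i) * row i)
            ≡⟨ LW.pair-sum 0<m 0<n (∑-countF (c ∘ inj₁)) (∑-countF (c ∘ inj₂)) ⟩
          (ι LW.K - 1ℚ) * (1ℚ - LW.s) ∎
          where
          row : Fin k → ℚ
          row i = sum (λ j → ι (countF (c ∘ inj₂) j) * off i (LW.gain i) j)

open import Data.Nat using (_+_; _*_)

theorem1p4 : (m n : ℕ) → 1 ≤ m → 1 ≤ n →
    (F : EdgeSet m n) → IsSpanningForest F →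
    (k : ℕ) (c : V m n → Fin k) →
    (∀ i → ∃ λ v → c v ≡ i) →
    (∀ u v → (c u ≡ c v) ⇔ Connected F u v) →
    (N : ℕ) → TauIs F N →
    m * n * N
    + sumF (λ i → countF (λ x → c (inj₁ x)) i * countF (λ y → c (inj₂ y)) i
    * prodExcept (λ j → countF (λ x → c (inj₁ x)) j * n + countF (λ y → c (inj₂ y)) j * m) i)
    ≡ prodF (λ i → countF (λ x → c (inj₁ x)) i * n + countF (λ y → c (inj₂ y)) i * m)
theorem1p4 m n 0<m 0<n F ac k c surj rep N tau =
  LabelWeights.value-all-alive c alive
    -- The induction needs only that K is a successor; it is positive because X has a vertex, whose
    -- label is in use.
    (tau-value 0<m 0<n (pred (LabelWeights.K c)) rep ac
      (sym (ℕ.suc-pred _ {{ℕ.>-nonZero (0<K c 0<m 0<n)}})) tau)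
  where
  alive : ∀ i → 0 < LabelWeights.W c i
  -- Here surjectivity enters: every label has a vertex, so no weight vanishes and all denominators
  -- can be cleared.
  alive i with v , refl ← surj i = label-alive c 0<m 0<n v
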